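{- Let $n \geq 3$ be an integer and let $q \geq 3$ be a prime power. Let $G_{\mathrm{pr}}(\mathbb{F}_q^n)$ be the phase-rotation distance graph, and let $\alpha_3$ denote the $3$-independence number. Then \[ \alpha_3(G_{\mathrm{pr}}(\mathbb{F}_q^n)) \leq q^n\, \frac{n(n+2q-1)+q \lceil \tfrac{n-1}{q} \rceil \big(-2n-q+q \lceil \tfrac{n-1}{q} \rceil \big)}{q^3 \big( n+\lfloor \tfrac{1-n}{q} \rfloor \big) \big( n+1+ \lfloor \tfrac{1-n}{q} \rfloor \big)}. \]
   Context: Let $\mathbf{e}_1,\ldots,\mathbf{e}_n$ be the standard basis of $\mathbb{F}_q^n$ and $\mathbf{1}$ the all-ones vector. Put $F_i=\mathrm{span}(\mathbf{e}_i)$ for $i=1,\ldots,n$ and $F_{n+1}=\mathrm{span}(\mathbf{1})$. The phase-rotation weight of $\mathbf{x}\in\mathbb{F}_q^n$ is $w_{\mathrm{pr}}(\mathbf{x})=\min\{|I| : I\subseteq\{1,\ldots,n+1\},\ \mathbf{x}\in\mathrm{span}(\bigcup_{i\in I}F_i)\}$, and the phase-rotation distance is $d_{\mathrm{pr}}(\mathbf{x},\mathbf{y})=w_{\mathrm{pr}}(\mathbf{x}-\mathbf{y})$. The phase-rotation distance graph $G_{\mathrm{pr}}(\mathbb{F}_q^n)$ is the graph with vertex set $\mathbb{F}_q^n$ in which $\mathbf{x},\mathbf{y}$ are adjacent if and only if $d_{\mathrm{pr}}(\mathbf{x},\mathbf{y})=1$. For a graph $G$, the $k$-independence number $\alpha_k(G)$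 is the size of the largest set of vertices such that any two distinct vertices in the set are at geodesic distance greater than $k$ in $G$. -}

module Defs where

open import Algebra.Apartness.Structures using (IsHeytingField)
open import Algebra.Bundles using (CommutativeRing)
import Algebra.Properties.Ring as RingProperties
open import Data.Bool.Base using (true; false)
open import Data.Fin.Base as Fin using (Fin; zero; suc; funToFin; finToFun)
import Data.Fin.Properties as Fin
open import Data.Fin.Subset using (Subset; _∈_; ∣_∣; ⊤; ⊥)
open import Data.Fin.Subset.Properties
  using (∉⊥; ∣p∣≤n; ∣⊥∣≡0; _∈?_; anySubset?)
open import Data.Integer.Base as ℤ using (ℤ; +_; 0ℤ; 1ℤ)
import Data.Integer.DivMod as ℤ
import Data.Integer.Properties as ℤ
import Data.Integer.GCD as ℤ
open import Data.Nat.Base as ℕ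
  using (ℕ; zero; suc; NonZero; _^_; _≤_; _<_; z≤n; s≤s)
import Data.Nat.GCD as ℕ
open import Data.Nat.Primality using (Prime)
import Data.Nat.Properties as ℕ
open import Data.Product using (∃; ∃₂; ∃-syntax; _×_; _,_; proj₁; proj₂)
open import Data.Rational.Base as ℚ using (ℚ; floor; ceiling)
import Data.Rational.Properties as ℚ
open import Data.Sum.Base using (inj₁; inj₂)
open import Data.Vec.Base
  using (Vec; []; _∷_; lookup; tabulate; replicate; map; zipWith; _[_]≔_; here; there)
open import Data.Vec.Properties using (tabulate-cong; tabulate∘lookup; lookup∘tabulate)
import Data.Vec.Properties as Vec
open import Function.Base using (_∘_)
open import Function.Bundles using (_↔_; Inverse; mk↔ₛ′)
open import Function.Properties.Inverse using (↔⇒↣)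
open import Level using (0ℓ)
open import Relation.Binary.Core using (Rel)
import Relation.Binary.Definitions as B
open import Relation.Binary.PropositionalEquality
open import Relation.Nullary using (Dec; yes; no; contradiction)
open import Relation.Nullary.Decidable using (map′; _×-dec_; _→-dec_; ¬?)
open import Relation.Unary using (Pred; Decidable; ｛_｝)

IsLeast IsGreatest : Pred ℕ 0ℓ → Pred ℕ 0ℓ
IsLeast    P m = P m × (∀ {k} → P k → m ≤ k)
IsGreatest P m = P m × (∀ {k} → P k → k ≤ m)

least : ∀ {P} → Decidable P → ∀ n → P n → ∃ (IsLeast P)
least     P? zero    p = zero , p , λ _ → z≤n
least {P} P? (suc n) p with P? zero
... | yes p₀ = zero , p₀ , λ _ → z≤n
... | no ¬p₀ with least (P? ∘ suc) n p
...   | m , pₘ , lb = suc m , pₘ , lb′ _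
  where
  lb′ : ∀ k → P k → suc m ≤ k
  lb′ zero    p₀ = contradiction p₀ ¬p₀
  lb′ (suc k) pₖ = s≤s (lb pₖ)

greatest : ∀ {P} → Decidable P → ∃ P →
           ∀ b → (∀ {k} → P k → k ≤ b) → ∃ (IsGreatest P)
greatest P? (k , p) zero    ub = k , p , λ pⱼ → ℕ.≤-trans (ub pⱼ) z≤n
greatest P? ∃p      (suc b) ub with P? (suc b)
... | yes p = suc b , p , ub
... | no ¬p = greatest P? ∃p b λ pⱼ →
  ℕ.≤-pred (ℕ.≤∧≢⇒< (ub pⱼ) λ { refl → ¬p pⱼ })

record FiniteGraph : Set₁ where
  infix 4 _~_ _~?_
  field
    Vertex      : Set
    order       : ℕ
    enumeration : Vertex ↔ Fin order
    _~_         : Rel Vertex 0ℓ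
    _~?_        : B.Decidable _~_
    ~-sym       : B.Symmetric _~_
    ~-irrefl    : B.Irreflexive _≡_ _~_

  open Inverse enumeration public
    using () renaming (to to index; from to vertex)

  index-vertex : ∀ i → index (vertex i) ≡ i
  index-vertex = Inverse.strictlyInverseˡ enumeration

  vertex-index : ∀ x → vertex (index x) ≡ x
  vertex-index = Inverse.strictlyInverseʳ enumeration

  _≟_ : B.DecidableEquality Vertex
  _≟_ = Fin.inj⇒≟ (↔⇒↣ enumeration)

  any? : ∀ {P : Pred Vertex 0ℓ} → Decidable P → Dec (∃ P)
  any? {P} P? = map′
    (λ (i , p) → vertex i , p)
    (λ (x , p) → index x , subst P (sym (vertex-index x)) p)
    (Fin.any? (P? ∘ vertex))

  all? : ∀ {P : Pred Vertex 0ℓ} → Decidable P → Dec (∀ x → P x)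
  all? {P} P? = map′
    (λ f x → subst P (vertex-index x) (f (index x)))
    (λ f i → f (vertex i))
    (Fin.all? (P? ∘ vertex))

  data Walk : Vertex → Vertex → ℕ → Set where
    []  : ∀ {x} → Walk x x 0
    _∷_ : ∀ {x y z l} → x ~ y → Walk y z l → Walk x z (suc l)

  walk? : ∀ x y l → Dec (Walk x y l)
  walk? x y zero    = map′ (λ { refl → [] }) (λ { [] → refl }) (x ≟ y)
  walk? x y (suc l) = map′
    (λ (_ , e , w) → e ∷ w) (λ { (e ∷ w) → _ , e , w })
    (any? λ z → (x ~? z) ×-dec walk? z y l)

  -- The geodesic distance is the infimum of the lengths of walks from
  -- x to y, and is infinite when there are none.
  DistanceExceeds : ℕ → Rel Vertex 0ℓ
  DistanceExceeds k x y = ∀ {l} → Walk x y l → k < l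

  distanceExceeds? : ∀ k → B.Decidable (DistanceExceeds k)
  distanceExceeds? k x y = map′
    (λ f {l} w → ℕ.≰⇒> λ l≤k → f (s≤s l≤k) w)
    (λ f {l} l<1+k w → ℕ.<⇒≱ (f w) (ℕ.≤-pred l<1+k))
    (ℕ.allUpTo? (λ l → ¬? (walk? x y l)) (suc k))

  VertexSet : Set
  VertexSet = Subset order

  Independent : ℕ → Pred VertexSet 0ℓ
  Independent k S = ∀ x y → index x ∈ S → index y ∈ S → x ≢ y →
                    DistanceExceeds k x y

  independent? : ∀ k → Decidable (Independent k)
  independent? k S = all? λ x → all? λ y →
    (index x ∈? S) →-dec (index y ∈? S) →-dec ¬? (x ≟ y) →-dec
    distanceExceeds? k x y

  IndependentOfSize : ℕ → Pred ℕ 0ℓ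
  IndependentOfSize k a = ∃[ S ] ∣ S ∣ ≡ a × Independent k S

  independenceNumber : ∀ k → ∃ (IsGreatest (IndependentOfSize k))
  independenceNumber k = greatest
    (λ a → anySubset? λ S → (∣ S ∣ ℕ.≟ a) ×-dec independent? k S)
    (0 , ⊥ , ∣⊥∣≡0 order , λ _ _ x∈⊥ → contradiction x∈⊥ ∉⊥)
    order (λ { (S , refl , _) → ∣p∣≤n S })

α : ℕ → FiniteGraph → ℕ
α k G = proj₁ (FiniteGraph.independenceNumber G k)

IsPrimePower : Pred ℕ 0ℓ
IsPrimePower q = ∃₂ λ p k → Prime p × 1 ≤ k × q ≡ p ^ k

-- Taking denial inequality as the apartness relation makes a Heyting
-- field an ordinary (discrete) field.
record FiniteField (q : ℕ) : Set₁ where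
  infixl 6 _+_
  infixl 7 _*_
  infix  8 -_
  field
    Carrier        : Set
    _+_ _*_        : Carrier → Carrier → Carrier
    -_             : Carrier → Carrier
    0# 1#          : Carrier
    isHeytingField : IsHeytingField _≡_ _≢_ _+_ _*_ -_ 0# 1#
    enumeration    : Carrier ↔ Fin q

  open IsHeytingField isHeytingField public
    using (isCommutativeRing; #⇒invertible; invertible⇒#)

  commutativeRing : CommutativeRing 0ℓ 0ℓ
  commutativeRing = record { isCommutativeRing = isCommutativeRing }

  _≟_ : B.DecidableEquality Carrier
  _≟_ = Fin.inj⇒≟ (↔⇒↣ enumeration)

Vec↔Fin : ∀ {A : Set} {q} → A ↔ Fin q → ∀ n → Vec A n ↔ Fin (q ^ n)
Vec↔Fin {A} {q} A↔Fin n = mk↔ₛ′ to′ from′ to∘from from∘to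
  where
  open Inverse A↔Fin

  to′ : Vec A n → Fin (q ^ n)
  to′ x = funToFin (to ∘ lookup x)

  from′ : Fin (q ^ n) → Vec A n
  from′ k = tabulate (from ∘ finToFun k)

  funToFin-cong : ∀ {m} {f g : Fin m → Fin q} → f ≗ g → funToFin f ≡ funToFin g
  funToFin-cong {zero}  f≗g = refl
  funToFin-cong {suc m} f≗g =
    cong₂ Fin.combine (f≗g zero) (funToFin-cong (f≗g ∘ suc))

  to∘from : ∀ k → to′ (from′ k) ≡ k
  to∘from k = trans
    (funToFin-cong {n} {to ∘ lookup (from′ k)} {finToFun k} λ i →
      trans (cong to (lookup∘tabulate (from ∘ finToFun k) i)) (strictlyInverseˡ _))
    (Fin.funToFin-finToFin {n} k)

  from∘to : ∀ x → from′ (to′ x) ≡ x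
  from∘to x = trans
    (tabulate-cong λ i → trans
      (cong from (Fin.finToFun-funToFin (to ∘ lookup x) i)) (strictlyInverseʳ _))
    (tabulate∘lookup x)

module PhaseRotation {q : ℕ} (F : FiniteField q) where

  open FiniteField F
  open CommutativeRing commutativeRing
    using (ring; +-assoc; +-comm; +-identityˡ; +-identityʳ; -‿inverseʳ;
           *-assoc; *-identityˡ; *-comm; distribʳ; zeroˡ; zeroʳ)
  open RingProperties ring
    using (-‿distribˡ-*; -‿+-comm; -0#≈0#; -‿involutive)

  infixl 6 _+ᵛ_ _-ᵛ_
  infixr 7 _·ᵛ_

  _+ᵛ_ _-ᵛ_ : ∀ {n} → Vec Carrier n → Vec Carrier n → Vec Carrier n
  _·ᵛ_      : ∀ {n} → Carrier → Vec Carrier n → Vec Carrier n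
  negᵛ      : ∀ {n} → Vec Carrier n → Vec Carrier n
  0ᵛ 1ᵛ     : ∀ {n} → Vec Carrier n
  x +ᵛ y = zipWith _+_ x y
  negᵛ x = map -_ x
  x -ᵛ y = x +ᵛ negᵛ y
  a ·ᵛ x = map (a *_) x
  0ᵛ     = replicate _ 0#
  1ᵛ     = replicate _ 1#

  𝐞 : ∀ {n} → Fin n → Vec Carrier n
  𝐞 i = 0ᵛ [ i ]≔ 1#

  data Span {n} (S : Pred (Vec Carrier n) 0ℓ) : Pred (Vec Carrier n) 0ℓ where
    zero  : Span S 0ᵛ
    _·_∷_ : ∀ a {s x} → S s → Span S x → Span S (a ·ᵛ s +ᵛ x)

  -- The all-ones vector, usually listed last, is put at index zero.
  generator : ∀ {n} → Fin (suc n) → Vec Carrier n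
  generator zero    = 1ᵛ
  generator (suc i) = 𝐞 i

  𝐅 : ∀ {n} → Fin (suc n) → Pred (Vec Carrier n) 0ℓ
  𝐅 i = Span ｛ generator i ｝

  ⋃𝐅 : ∀ {n} → Subset (suc n) → Pred (Vec Carrier n) 0ℓ
  ⋃𝐅 I x = ∃[ i ] i ∈ I × 𝐅 i x

  +ᵛ-assoc : ∀ {n} (x y z : Vec Carrier n) → (x +ᵛ y) +ᵛ z ≡ x +ᵛ (y +ᵛ z)
  +ᵛ-assoc = Vec.zipWith-assoc +-assoc

  +ᵛ-comm : ∀ {n} (x y : Vec Carrier n) → x +ᵛ y ≡ y +ᵛ x
  +ᵛ-comm = Vec.zipWith-comm +-comm

  +ᵛ-identityˡ : ∀ {n} (x : Vec Carrier n) → 0ᵛ +ᵛ x ≡ x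
  +ᵛ-identityˡ = Vec.zipWith-identityˡ +-identityˡ

  +ᵛ-inverseʳ : ∀ {n} (x : Vec Carrier n) → x -ᵛ x ≡ 0ᵛ
  +ᵛ-inverseʳ []      = refl
  +ᵛ-inverseʳ (x ∷ v) = cong₂ _∷_ (-‿inverseʳ x) (+ᵛ-inverseʳ v)

  ·ᵛ-distribʳ : ∀ {n} a b (x : Vec Carrier n) → (a + b) ·ᵛ x ≡ a ·ᵛ x +ᵛ b ·ᵛ x
  ·ᵛ-distribʳ a b []      = refl
  ·ᵛ-distribʳ a b (x ∷ v) = cong₂ _∷_ (distribʳ x a b) (·ᵛ-distribʳ a b v)

  ·ᵛ-assoc : ∀ {n} a b (x : Vec Carrier n) → a ·ᵛ b ·ᵛ x ≡ (a * b) ·ᵛ x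
  ·ᵛ-assoc a b []      = refl
  ·ᵛ-assoc a b (x ∷ v) = cong₂ _∷_ (sym (*-assoc a b x)) (·ᵛ-assoc a b v)

  ·ᵛ-identity : ∀ {n} (x : Vec Carrier n) → 1# ·ᵛ x ≡ x
  ·ᵛ-identity []      = refl
  ·ᵛ-identity (x ∷ v) = cong₂ _∷_ (*-identityˡ x) (·ᵛ-identity v)

  ·ᵛ-zeroˡ : ∀ {n} (x : Vec Carrier n) → 0# ·ᵛ x ≡ 0ᵛ
  ·ᵛ-zeroˡ []      = refl
  ·ᵛ-zeroˡ (x ∷ v) = cong₂ _∷_ (zeroˡ x) (·ᵛ-zeroˡ v)

  ·ᵛ-zeroʳ : ∀ {n} a → a ·ᵛ 0ᵛ {n} ≡ 0ᵛ
  ·ᵛ-zeroʳ {zero}  a = refl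
  ·ᵛ-zeroʳ {suc n} a = cong₂ _∷_ (zeroʳ a) (·ᵛ-zeroʳ a)

  negᵛ-0ᵛ : ∀ {n} → negᵛ (0ᵛ {n}) ≡ 0ᵛ
  negᵛ-0ᵛ {zero}  = refl
  negᵛ-0ᵛ {suc n} = cong₂ _∷_ -0#≈0# negᵛ-0ᵛ

  negᵛ-distrib : ∀ {n} a (s x : Vec Carrier n) →
               negᵛ (a ·ᵛ s +ᵛ x) ≡ (- a) ·ᵛ s +ᵛ (negᵛ x)
  negᵛ-distrib a []      []      = refl
  negᵛ-distrib a (s ∷ u) (x ∷ v) = cong₂ _∷_
    (trans (sym (-‿+-comm (a * s) x)) (cong (_+ (- x)) (-‿distribˡ-* a s)))
    (negᵛ-distrib a u v)

  negᵛ-swap : ∀ {n} (x y : Vec Carrier n) → negᵛ (x -ᵛ y) ≡ y -ᵛ x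
  negᵛ-swap []      []      = refl
  negᵛ-swap (x ∷ v) (y ∷ w) = cong₂ _∷_
    (trans (sym (-‿+-comm x (- y)))
           (trans (cong (λ z → (- x) + z) (-‿involutive y)) (+-comm (- x) y)))
    (negᵛ-swap v w)

  span-neg : ∀ {n} {S : Pred (Vec Carrier n) 0ℓ} {x} → Span S x → Span S (negᵛ x)
  span-neg {S = S} zero                    = subst (Span S) (sym negᵛ-0ᵛ) zero
  span-neg {S = S} (_·_∷_ a {s} {x} s∈ x∈) =
    subst (Span S) (sym (negᵛ-distrib a s x)) ((- a) · s∈ ∷ span-neg x∈)

  𝐅-multiple : ∀ {n} i {x : Vec Carrier n} → 𝐅 i x → ∃[ a ] x ≡ a ·ᵛ generator i
  𝐅-multiple i zero = 0# , sym (·ᵛ-zeroˡ _)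
  𝐅-multiple i (a · refl ∷ x∈) with 𝐅-multiple i x∈
  ... | b , refl = a + b , sym (·ᵛ-distribʳ a b _)

  combination : ∀ {n m} → (Fin m → Vec Carrier n) → Subset m → Vec Carrier m →
                Vec Carrier n
  combination g []          []       = 0ᵛ
  combination g (true  ∷ I) (c ∷ cs) = c ·ᵛ g zero +ᵛ combination (g ∘ suc) I cs
  combination g (false ∷ I) (c ∷ cs) = combination (g ∘ suc) I cs

  combination-zero : ∀ {n m} (g : Fin m → Vec Carrier n) I → combination g I 0ᵛ ≡ 0ᵛ
  combination-zero g []          = refl
  combination-zero g (true  ∷ I) = trans
    (cong₂ _+ᵛ_ (·ᵛ-zeroˡ _) (combination-zero (g ∘ suc) I)) (+ᵛ-identityˡ _)
  combination-zero g (false ∷ I) = combination-zero (g ∘ suc) I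

  combination-add : ∀ {n m} (g : Fin m → Vec Carrier n) I {i} → i ∈ I → ∀ a cs →
                    ∃[ ds ] a ·ᵛ g i +ᵛ combination g I cs ≡ combination g I ds
  combination-add g (true ∷ I) {zero} _ a (c ∷ cs) = a + c ∷ cs ,
    trans (sym (+ᵛ-assoc _ _ _)) (cong (_+ᵛ _) (sym (·ᵛ-distribʳ a c _)))
  combination-add g (true ∷ I) {suc i} (there i∈) a (c ∷ cs)
    with combination-add (g ∘ suc) I i∈ a cs
  ... | ds , eq = c ∷ ds ,
    trans (sym (+ᵛ-assoc u v w)) (trans (cong (_+ᵛ w) (+ᵛ-comm u v))
      (trans (+ᵛ-assoc v u w) (cong (v +ᵛ_) eq)))
    where
    u = a ·ᵛ g (suc i)
    v = c ·ᵛ g zero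
    w = combination (g ∘ suc) I cs
  combination-add g (false ∷ I) {suc i} (there i∈) a (c ∷ cs)
    with combination-add (g ∘ suc) I i∈ a cs
  ... | ds , eq = c ∷ ds , eq

  combination∈ : ∀ {n m} (g : Fin m → Vec Carrier n) I cs {S : Pred (Vec Carrier n) 0ℓ} →
                 (∀ {i} → i ∈ I → S (g i)) → Span S (combination g I cs)
  combination∈ g []          []       g∈ = zero
  combination∈ g (true  ∷ I) (c ∷ cs) g∈ =
    c · g∈ here ∷ combination∈ (g ∘ suc) I cs (g∈ ∘ there)
  combination∈ g (false ∷ I) (c ∷ cs) g∈ =
    combination∈ (g ∘ suc) I cs (g∈ ∘ there)

  generator∈𝐅 : ∀ {n} (i : Fin (suc n)) → 𝐅 i (generator i)
  generator∈𝐅 i = subst (𝐅 i)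
    (trans (Vec.zipWith-identityʳ +-identityʳ _) (·ᵛ-identity _)) (1# · refl ∷ zero)

  combination⇒span : ∀ {n} (I : Subset (suc n)) {x} →
                     (∃[ cs ] x ≡ combination generator I cs) → Span (⋃𝐅 I) x
  combination⇒span I (cs , refl) =
    combination∈ generator I cs (λ {i} i∈I → i , i∈I , generator∈𝐅 i)

  span⇒combination : ∀ {n} (I : Subset (suc n)) {x} →
                     Span (⋃𝐅 I) x → ∃[ cs ] x ≡ combination generator I cs
  span⇒combination I zero = 0ᵛ , sym (combination-zero generator I)
  span⇒combination I (a · (i , i∈I , s∈) ∷ x∈)
    with 𝐅-multiple i s∈ | span⇒combination I x∈
  ... | b , refl | cs , refl with combination-add generator I i∈I (a * b) cs
  ...   | ds , eq = ds , trans (cong (_+ᵛ _) (·ᵛ-assoc a b _)) eq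

  _≟ᵛ_ : ∀ {n} → B.DecidableEquality (Vec Carrier n)
  _≟ᵛ_ = Vec.≡-dec _≟_

  anyVec? : ∀ {n} {P : Pred (Vec Carrier n) 0ℓ} → Decidable P → Dec (∃ P)
  anyVec? {n} {P} P? = map′
    (λ (k , p) → from k , p)
    (λ (x , p) → to x , subst P (sym (strictlyInverseʳ x)) p)
    (Fin.any? (P? ∘ from))
    where open Inverse (Vec↔Fin enumeration n)

  span? : ∀ {n} (I : Subset (suc n)) → Decidable (Span (⋃𝐅 I))
  span? I x = map′ (combination⇒span I) (span⇒combination I)
    (anyVec? λ cs → x ≟ᵛ combination generator I cs)

  SpannedBy : ∀ {n} → Vec Carrier n → Pred ℕ 0ℓ
  SpannedBy {n} x w = ∃[ I ] ∣ I ∣ ≡ w × Span (⋃𝐅 {n} I) x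

  spannedBy? : ∀ {n} (x : Vec Carrier n) → Decidable (SpannedBy x)
  spannedBy? x w = anySubset? λ I → (∣ I ∣ ℕ.≟ w) ×-dec span? I x

  combination-0∷ : ∀ {n m} (g : Fin m → Vec Carrier n) I cs →
                   combination (λ i → 0# ∷ g i) I cs ≡ 0# ∷ combination g I cs
  combination-0∷ g []          []       = refl
  combination-0∷ g (true  ∷ I) (c ∷ cs) = trans
    (cong (_ +ᵛ_) (combination-0∷ (g ∘ suc) I cs))
    (cong (_∷ (c ·ᵛ g zero +ᵛ combination (g ∘ suc) I cs))
      (trans (+-identityʳ _) (zeroʳ c)))
  combination-0∷ g (false ∷ I) (c ∷ cs) = combination-0∷ (g ∘ suc) I cs

  combination-𝐞 : ∀ {n} (x : Vec Carrier n) → combination 𝐞 ⊤ x ≡ x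
  combination-𝐞 []      = refl
  combination-𝐞 (x ∷ v) = trans
    (cong (_ +ᵛ_) (combination-0∷ 𝐞 ⊤ v))
    (cong₂ _∷_
      (trans (+-identityʳ _) (trans (*-comm x 1#) (*-identityˡ x)))
      (trans (cong₂ _+ᵛ_ (·ᵛ-zeroʳ x) (combination-𝐞 v)) (+ᵛ-identityˡ v)))

  span-⊤ : ∀ {n} (x : Vec Carrier n) → Span (⋃𝐅 ⊤) x
  span-⊤ x = combination⇒span ⊤ (0# ∷ x , sym
    (trans (cong₂ _+ᵛ_ (·ᵛ-zeroˡ 1ᵛ) (combination-𝐞 x)) (+ᵛ-identityˡ x)))

  weight : ∀ {n} (x : Vec Carrier n) → ∃ (IsLeast (SpannedBy x))
  weight x = least (spannedBy? x) _ (⊤ , refl , span-⊤ x)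

  w-pr : ∀ {n} → Vec Carrier n → ℕ
  w-pr x = proj₁ (weight x)

  d-pr : ∀ {n} → Vec Carrier n → Vec Carrier n → ℕ
  d-pr x y = w-pr (x -ᵛ y)

  w-pr-neg≤ : ∀ {n} (x : Vec Carrier n) → w-pr (negᵛ x) ≤ w-pr x
  w-pr-neg≤ x with weight x | weight (negᵛ x)
  ... | w , (I , ∣I∣≡w , x∈) , _ | w′ , _ , w′≤ = w′≤ (I , ∣I∣≡w , span-neg x∈)

  d-pr-sym : ∀ {n} (x y : Vec Carrier n) → d-pr x y ≡ d-pr y x
  d-pr-sym x y = ℕ.≤-antisym (d-pr-≤ x y) (d-pr-≤ y x)
    where
    d-pr-≤ : ∀ x y → d-pr x y ≤ d-pr y x
    d-pr-≤ x y = subst (λ z → w-pr z ≤ d-pr y x) (negᵛ-swap y x) (w-pr-neg≤ (y -ᵛ x))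

  d-pr-refl : ∀ {n} (x : Vec Carrier n) → d-pr x x ≡ 0
  d-pr-refl {n} x with weight (x -ᵛ x)
  ... | w , _ , w≤ = ℕ.n≤0⇒n≡0 (w≤
    (⊥ , ∣⊥∣≡0 (suc n) , subst (Span (⋃𝐅 ⊥)) (sym (+ᵛ-inverseʳ x)) zero))

  G-pr : ℕ → FiniteGraph
  G-pr n = record
    { Vertex      = Vec Carrier n
    ; order       = q ^ n
    ; enumeration = Vec↔Fin enumeration n
    ; _~_         = λ x y → d-pr x y ≡ 1
    ; _~?_        = λ x y → d-pr x y ℕ.≟ 1
    ; ~-sym       = λ {x} {y} → trans (d-pr-sym y x)
    ; ~-irrefl    = λ { {x} refl d≡1 → ℕ.0≢1+n (trans (sym (d-pr-refl x)) d≡1) }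
    }

open PhaseRotation using (G-pr) public

fromℤ : ℤ → ℚ
fromℤ i = i ℚ./ 1

≤/ : ∀ i j d .{{_ : NonZero d}} → i ℤ.* + d ℤ.≤ j → i ℤ.≤ j ℤ./ + d
≤/ i j d i*d≤j = subst (i ℤ.≤_) (ℤ.pred-suc (j ℤ./ + d))
  (ℤ.i<j⇒i≤pred[j] (ℤ.*-cancelʳ-<-nonNeg {j = ℤ.suc (j ℤ./ + d)} (+ d) (begin-strict
    i ℤ.* + d                    ≤⟨ i*d≤j ⟩
    j                            <⟨ ℤ.n<s[n/ℕd]*d j d ⟩
    ℤ.suc (j ℤ./ℕ d) ℤ.* + d     ≡⟨ cong (λ k → ℤ.suc k ℤ.* + d) (ℤ.div-pos-is-/ℕ j d) ⟨
    ℤ.suc (j ℤ./ + d) ℤ.* + d    ∎)))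
  where open ℤ.≤-Reasoning

≤floor : ∀ i p → i ℤ.* ℚ.↧ p ℤ.≤ ℚ.↥ p → i ℤ.≤ floor p
≤floor i p@record{} i*↧p≤↥p = ≤/ i (ℚ.↥ p) (ℚ.↧ₙ p) i*↧p≤↥p

≤floor-/ : ∀ i j d .{{_ : NonZero d}} → i ℤ.* + d ℤ.≤ j → i ℤ.≤ floor (j ℚ./ d)
≤floor-/ i j d@(suc _) i*d≤j =
  ≤floor i p (ℤ.*-cancelʳ-≤-pos (i ℤ.* ℚ.↧ p) (ℚ.↥ p) g {{g>0}} (begin
    i ℤ.* ℚ.↧ p ℤ.* g    ≡⟨ ℤ.*-assoc i (ℚ.↧ p) g ⟩
    i ℤ.* (ℚ.↧ p ℤ.* g)  ≡⟨ cong (i ℤ.*_) (ℚ.↧-/ j d) ⟩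
    i ℤ.* + d            ≤⟨ i*d≤j ⟩
    j                    ≡⟨ ℚ.↥-/ j d ⟨
    ℚ.↥ p ℤ.* g          ∎))
  where
  open ℤ.≤-Reasoning
  p = j ℚ./ d
  g = ℤ.gcd j (+ d)
  g>0 : ℤ.Positive g
  g>0 = ℤ.positive (ℤ.+<+ (ℕ.n≢0⇒n>0 (ℕ.gcd[m,n]≢0 ℤ.∣ j ∣ d (inj₂ λ ()))))

fromℤ-pos : ∀ {i} → ℤ.Positive i → ℚ.Positive (fromℤ i)
fromℤ-pos {+ suc k} _ = ℚ.normalize-pos (suc k) 1

pos*pos : ∀ {i j} → 0ℤ ℤ.< i → 0ℤ ℤ.< j → 0ℤ ℤ.< i ℤ.* j
pos*pos {+ suc _} {+ suc _} _ _ = ℤ.+<+ (s≤s z≤n)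
pos*pos {+ zero} (ℤ.+<+ ())
pos*pos {+ suc _} {+ zero} _ (ℤ.+<+ ())

module _ (n q : ℕ) .{{_ : NonZero n}} .{{_ : NonZero q}} where

  ⌈[n-1]/q⌉ ⌊[1-n]/q⌋ : ℤ
  ⌈[n-1]/q⌉ = ceiling ((+ n ℤ.- 1ℤ) ℚ./ q)
  ⌊[1-n]/q⌋ = floor ((1ℤ ℤ.- + n) ℚ./ q)

  numerator denominator : ℤ
  numerator =
    + n ℤ.* (+ n ℤ.+ + 2 ℤ.* + q ℤ.- 1ℤ) ℤ.+
    + q ℤ.* ⌈[n-1]/q⌉ ℤ.* (ℤ.- + 2 ℤ.* + n ℤ.- + q ℤ.+ + q ℤ.* ⌈[n-1]/q⌉)
  denominator =
    + (q ^ 3) ℤ.* (+ n ℤ.+ ⌊[1-n]/q⌋) ℤ.* (+ n ℤ.+ 1ℤ ℤ.+ ⌊[1-n]/q⌋)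

  1-n≤⌊[1-n]/q⌋ : 1ℤ ℤ.- + n ℤ.≤ ⌊[1-n]/q⌋
  1-n≤⌊[1-n]/q⌋ = ≤floor-/ i i q (begin
    i ℤ.* + q  ≤⟨ ℤ.*-monoˡ-≤-nonPos i {{ℤ.nonPositive (ℤ.i≤j⇒i-j≤0 1≤n)}} 1≤q ⟩
    i ℤ.* 1ℤ   ≡⟨ ℤ.*-identityʳ i ⟩
    i          ∎)
    where
    open ℤ.≤-Reasoning
    i = 1ℤ ℤ.- + n
    1≤n : 1ℤ ℤ.≤ + n
    1≤n = ℤ.+≤+ (ℕ.>-nonZero⁻¹ n)
    1≤q : 1ℤ ℤ.≤ + q
    1≤q = ℤ.+≤+ (ℕ.>-nonZero⁻¹ q)

  0<n+⌊[1-n]/q⌋ : 0ℤ ℤ.< + n ℤ.+ ⌊[1-n]/q⌋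
  0<n+⌊[1-n]/q⌋ = begin-strict
    0ℤ                       <⟨ ℤ.+<+ (s≤s z≤n) ⟩
    1ℤ ℤ.+ 0ℤ                ≡⟨ cong (λ i → 1ℤ ℤ.+ i) (ℤ.+-inverseˡ (+ n)) ⟨
    1ℤ ℤ.+ (ℤ.- + n ℤ.+ + n) ≡⟨ ℤ.+-assoc 1ℤ (ℤ.- + n) (+ n) ⟨
    1ℤ ℤ.- + n ℤ.+ + n       ≡⟨ ℤ.+-comm (1ℤ ℤ.- + n) (+ n) ⟩
    + n ℤ.+ (1ℤ ℤ.- + n)     ≤⟨ ℤ.+-monoʳ-≤ (+ n) 1-n≤⌊[1-n]/q⌋ ⟩
    + n ℤ.+ ⌊[1-n]/q⌋        ∎
    where open ℤ.≤-Reasoning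

  0<denominator : 0ℤ ℤ.< denominator
  0<denominator = pos*pos
    (pos*pos (ℤ.+<+ (ℕ.>-nonZero⁻¹ (q ^ 3) {{ℕ.m^n≢0 q 3}})) 0<n+⌊[1-n]/q⌋)
    (ℤ.<-≤-trans 0<n+⌊[1-n]/q⌋
      (ℤ.+-monoˡ-≤ ⌊[1-n]/q⌋ (ℤ.i≤i+j (+ n) 1ℤ)))

  instance
    denominator≢0 : ℚ.NonZero (fromℤ denominator)
    denominator≢0 = ℚ.pos⇒nonZero (fromℤ denominator) {{fromℤ-pos (ℤ.positive 0<denominator)}}

  bound : ℚ
  bound = fromℤ (+ (q ^ n)) ℚ.* (fromℤ numerator ℚ.÷ fromℤ denominator)

{-# OPTIONS --safe #-}

-- Let P g be the averaging projection along the line spanned by g.  The n + 1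
-- projections commute, and the adjacency operator is q ∑ P g - (n + 1), so its
-- spectral theory is available over ℤ without any characters: the eigenvalue of
-- ∑ P g on a common eigenvector is the number t of projections fixing it.  For
-- every integer c the cubic φ(t) = t (t - c) (t - c - 1) is nonnegative at all
-- integers t ≥ 0, so ⟨ f , φ(∑ P g) f ⟩ ≥ φ(n + 1) ∥ ∏ P g f ∥², which by
-- Cauchy-Schwarz is at least φ(n + 1) (∑ f)² / qⁿ.  When f is the indicator of
-- a 3-independent set, only the diagonal of φ(∑ P g) contributes to the left
-- hand side, and the diagonal is constant because any three generators are
-- linearly independent.  The theorem is the case c = ⌈(n - 1) / q⌉.
module Submission where

open import Defs
open import Algebra.Apartness.Bundles using (HeytingCommutativeRing)
open import Algebra.Apartness.Structures using (module IsHeytingField)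
import Algebra.Apartness.Properties.HeytingCommutativeRing as Heyting
open import Algebra.Bundles using (CommutativeRing)
import Algebra.Properties.Semiring.Sum as SemiringSum
open import Data.Bool.Base using (Bool; true; false; if_then_else_)
open import Data.Fin.Base using (Fin; zero; suc; punchIn)
open import Data.Fin.Permutation using (Permutation)
import Data.Fin.Properties as Fin
open import Data.Fin.Subset using (Subset; _∈_; ⁅_⁆; ∣_∣)
open import Data.Fin.Subset.Properties using (x∈⁅x⁆; ∣⁅x⁆∣≡1; x∈⁅y⁆⇒x≡y)
open import Data.Integer.Base
  using (ℤ; +_; -[1+_]; 0ℤ; 1ℤ; _+_; _-_; _*_; -_; _<_; +≤+; +<+; positive; nonNegative; NonNegative)
  renaming (_^_ to _^ᶻ_; _≤_ to _≤ᶻ_)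
import Data.Integer.Properties as ℤ
open import Data.Integer.Tactic.RingSolver using (solve-∀)
open import Data.List.Base using (List; []; _∷_; length; lookup; map; foldr; allFin)
open import Data.List.Membership.DecPropositional using () renaming (_∈?_ to ∈ₗ?)
open import Data.List.Membership.Propositional using () renaming (_∈_ to _∈ₗ_)
import Data.List.Properties as List
open import Data.List.Relation.Unary.All as All using (All; []; _∷_)
open import Data.List.Relation.Unary.AllPairs using ([]; _∷_)
import Data.List.Relation.Unary.Any as Any
import Data.List.Relation.Unary.Any.Properties as Any
open import Data.List.Relation.Unary.Unique.Propositional using (Unique)
import Data.List.Relation.Unary.Unique.Propositional.Properties as Unique
open import Data.Nat.Base as ℕ using (ℕ; zero; suc; NonZero; _≤_; s≤s; z≤n)
import Data.Nat.Properties as ℕ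
open import Data.Product using (∃-syntax; _×_; _,_; proj₁; proj₂)
import Data.Rational.Base as ℚ
import Data.Rational.Properties as ℚ
import Data.Rational.Unnormalised.Base as ℚᵘ
import Data.Rational.Unnormalised.Properties as ℚᵘ
open import Data.Vec.Base as Vec using (Vec; []; _∷_; here; there)
import Data.Vec.Properties as Vec
open import Function.Base using (_∘_)
open import Function.Bundles using (_↔_; Inverse; mk↔ₛ′)
open import Relation.Binary.PropositionalEquality
open import Relation.Nullary using (¬?; yes; no; contradiction)

open SemiringSum (CommutativeRing.semiring ℤ.+-*-commutativeRing)
  using (sum; sum-cong-≗; sum-remove; sum-permute; sum-replicate-zero;
         ∑-comm; ∑-distrib-+; *-distribˡ-sum)

-- Integer sums indexed by `Fin`.

square-nonNeg : ∀ i → 0ℤ ≤ᶻ i * i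
square-nonNeg (+ m)    = subst (0ℤ ≤ᶻ_) (ℤ.pos-* m m) (+≤+ z≤n)
square-nonNeg -[1+ m ] = +≤+ z≤n

sum-const : ∀ k (c : ℤ) → sum {k} (λ _ → c) ≡ + k * c
sum-const zero    c = refl
sum-const (suc k) c = trans (cong (_+_ c) (sum-const k c)) (step c (+ k))
  where
  step : ∀ c k → c + k * c ≡ (1ℤ + k) * c
  step = solve-∀

sum-nonNeg : ∀ {k} {h : Fin k → ℤ} → (∀ i → 0ℤ ≤ᶻ h i) → 0ℤ ≤ᶻ sum h
sum-nonNeg {zero}  0≤h = ℤ.≤-refl
sum-nonNeg {suc k} 0≤h = ℤ.+-mono-≤ (0≤h zero) (sum-nonNeg (0≤h ∘ suc))

sum-single : ∀ {k} {h : Fin k → ℤ} i → (∀ j → j ≢ i → h j ≡ 0ℤ) → sum h ≡ h i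
sum-single {suc k} {h} i h≡0 = begin
  sum h                          ≡⟨ sum-remove {i = i} h ⟩
  h i + sum (h ∘ punchIn i)      ≡⟨ cong (_+_ (h i)) (sum-cong-≗ λ j →
                                      h≡0 _ (Fin.punchInᵢ≢i i j)) ⟩
  h i + sum {k} (λ _ → 0ℤ)       ≡⟨ cong (_+_ (h i)) (sum-replicate-zero k) ⟩
  h i + 0ℤ                       ≡⟨ ℤ.+-identityʳ (h i) ⟩
  h i                            ∎
  where open ≡-Reasoning

indicator : Bool → ℤ
indicator b = if b then 1ℤ else 0ℤ

sum-indicator : ∀ {k} (S : Subset k) → sum (indicator ∘ Vec.lookup S) ≡ + ∣ S ∣
sum-indicator []          = refl
sum-indicator (true  ∷ S) = cong (_+_ 1ℤ) (sum-indicator S)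
sum-indicator (false ∷ S) = trans (ℤ.+-identityˡ _) (sum-indicator S)

-- Sums and the inner product over a finite type.

module FiniteSum {A : Set} {k} (A↔Fin : A ↔ Fin k) where

  open Inverse A↔Fin using (to; from; strictlyInverseˡ; strictlyInverseʳ)

  opaque
    ∑ : (A → ℤ) → ℤ
    ∑ h = sum (h ∘ from)

    ∑-cong : ∀ {f g} → f ≗ g → ∑ f ≡ ∑ g
    ∑-cong f≗g = sum-cong-≗ (f≗g ∘ from)

    ∑-const : ∀ c → ∑ (λ _ → c) ≡ + k * c
    ∑-const = sum-const k

    ∑-*ˡ : ∀ c f → ∑ (λ x → c * f x) ≡ c * ∑ f
    ∑-*ˡ c f = sym (*-distribˡ-sum c (f ∘ from))

    ∑-linear : ∀ a b f g → ∑ (λ x → a * f x + b * g x) ≡ a * ∑ f + b * ∑ g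
    ∑-linear a b f g = trans
      (∑-distrib-+ ((λ x → a * f x) ∘ from) ((λ x → b * g x) ∘ from))
      (cong₂ _+_ (∑-*ˡ a f) (∑-*ˡ b g))

    ∑-nonNeg : ∀ {f} → (∀ x → 0ℤ ≤ᶻ f x) → 0ℤ ≤ᶻ ∑ f
    ∑-nonNeg 0≤f = sum-nonNeg (0≤f ∘ from)

    ∑-reindex : ∀ (π π⁻¹ : A → A) → (∀ x → π (π⁻¹ x) ≡ x) → (∀ x → π⁻¹ (π x) ≡ x) →
                ∀ f → ∑ f ≡ ∑ (f ∘ π)
    ∑-reindex π π⁻¹ π∘π⁻¹ π⁻¹∘π f =
      trans (sum-permute (f ∘ from) σ) (sum-cong-≗ {n = k} λ i → cong f (strictlyInverseʳ (π (from i))))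
      where
      inverse : ∀ (ρ ρ⁻¹ : A → A) → (∀ x → ρ (ρ⁻¹ x) ≡ x) → ∀ i →
                to (ρ (from (to (ρ⁻¹ (from i))))) ≡ i
      inverse ρ ρ⁻¹ eq i = trans
        (cong to (trans (cong ρ (strictlyInverseʳ _)) (eq (from i))))
        (strictlyInverseˡ i)

      σ : Permutation k k
      σ = mk↔ₛ′ (to ∘ π ∘ from) (to ∘ π⁻¹ ∘ from)
        (inverse π π⁻¹ π∘π⁻¹) (inverse π⁻¹ π π⁻¹∘π)

    ∑-single : ∀ {f} x → (∀ y → y ≢ x → f y ≡ 0ℤ) → ∑ f ≡ f x
    ∑-single {f} x f≡0 = trans
      (sum-single (to x) λ j j≢ → f≡0 (from j) λ { refl → j≢ (sym (strictlyInverseˡ j)) })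
      (cong f (strictlyInverseʳ x))

  opaque
    unfolding ∑

    ∑-indicator : ∀ S → ∑ (λ x → indicator (Vec.lookup S (to x))) ≡ + ∣ S ∣
    ∑-indicator S = trans
      (sum-cong-≗ λ i → cong (indicator ∘ Vec.lookup S) (strictlyInverseˡ i))
      (sum-indicator S)

  opaque
    ⟨_,_⟩ : (A → ℤ) → (A → ℤ) → ℤ
    ⟨ f , g ⟩ = ∑ (λ x → f x * g x)

    ⟨,⟩-∑ : ∀ f g → ⟨ f , g ⟩ ≡ ∑ (λ x → f x * g x)
    ⟨,⟩-∑ f g = refl

  ⟨,⟩-cong : ∀ {f f′ g g′} → f ≗ f′ → g ≗ g′ → ⟨ f , g ⟩ ≡ ⟨ f′ , g′ ⟩
  ⟨,⟩-cong {f} {f′} {g} {g′} f≗f′ g≗g′ = trans (⟨,⟩-∑ f g)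
    (trans (∑-cong λ x → cong₂ _*_ (f≗f′ x) (g≗g′ x)) (sym (⟨,⟩-∑ f′ g′)))

  ⟨,⟩-constˡ : ∀ c f → ⟨ (λ _ → c) , f ⟩ ≡ c * ∑ f
  ⟨,⟩-constˡ c f = trans (⟨,⟩-∑ _ f) (∑-*ˡ c f)

  ⟨,⟩-linearʳ : ∀ h a b f g →
                ⟨ h , (λ x → a * f x + b * g x) ⟩ ≡ a * ⟨ h , f ⟩ + b * ⟨ h , g ⟩
  ⟨,⟩-linearʳ h a b f g = begin
    ⟨ h , (λ x → a * f x + b * g x) ⟩          ≡⟨ ⟨,⟩-∑ h _ ⟩
    ∑ (λ x → h x * (a * f x + b * g x))        ≡⟨ ∑-cong (λ x →
                                                    distrib (h x) a b (f x) (g x)) ⟩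
    ∑ (λ x → a * (h x * f x) + b * (h x * g x)) ≡⟨ ∑-linear a b _ _ ⟩
    a * ∑ (λ x → h x * f x) + b * ∑ (λ x → h x * g x)
                                               ≡⟨ cong₂ (λ s t → a * s + b * t)
                                                    (⟨,⟩-∑ h f) (⟨,⟩-∑ h g) ⟨
    a * ⟨ h , f ⟩ + b * ⟨ h , g ⟩              ∎
    where
    open ≡-Reasoning
    distrib : ∀ h a b f g → h * (a * f + b * g) ≡ a * (h * f) + b * (h * g)
    distrib = solve-∀

  ⟨,⟩-*ʳ : ∀ h a f → ⟨ h , (λ x → a * f x) ⟩ ≡ a * ⟨ h , f ⟩
  ⟨,⟩-*ʳ h a f = trans (⟨,⟩-∑ h _)
    (trans (∑-cong λ x → swap (h x) a (f x))
      (trans (∑-*ˡ a _) (cong (a *_) (sym (⟨,⟩-∑ h f)))))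
    where
    swap : ∀ h a f → h * (a * f) ≡ a * (h * f)
    swap = solve-∀

  ⟨,⟩-comm : ∀ f g → ⟨ f , g ⟩ ≡ ⟨ g , f ⟩
  ⟨,⟩-comm f g = trans (⟨,⟩-∑ f g)
    (trans (∑-cong λ x → ℤ.*-comm (f x) (g x)) (sym (⟨,⟩-∑ g f)))

  ⟨,⟩-linearˡ : ∀ h a b f g →
                ⟨ (λ x → a * f x + b * g x) , h ⟩ ≡ a * ⟨ f , h ⟩ + b * ⟨ g , h ⟩
  ⟨,⟩-linearˡ h a b f g = begin
    ⟨ (λ x → a * f x + b * g x) , h ⟩  ≡⟨ ⟨,⟩-comm (λ x → a * f x + b * g x) h ⟩
    ⟨ h , (λ x → a * f x + b * g x) ⟩  ≡⟨ ⟨,⟩-linearʳ h a b f g ⟩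
    a * ⟨ h , f ⟩ + b * ⟨ h , g ⟩      ≡⟨ cong₂ (λ s t → a * s + b * t)
                                            (⟨,⟩-comm h f) (⟨,⟩-comm h g) ⟩
    a * ⟨ f , h ⟩ + b * ⟨ g , h ⟩      ∎
    where open ≡-Reasoning

  ⟨,⟩-nonNeg : ∀ f → 0ℤ ≤ᶻ ⟨ f , f ⟩
  ⟨,⟩-nonNeg f = subst (0ℤ ≤ᶻ_) (sym (⟨,⟩-∑ f f)) (∑-nonNeg (square-nonNeg ∘ f))

  -- Nonnegativity of the variance: `g` is `k` times the deviation of `f` from its mean, scaled to
  -- stay in ℤ, and `⟨ g , g ⟩` is `k` times the difference of the two sides.
  cauchy-schwarz : .{{NonZero k}} → ∀ f → ∑ f * ∑ f ≤ᶻ + k * ⟨ f , f ⟩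
  cauchy-schwarz f = ℤ.0≤i-j⇒j≤i (ℤ.*-cancelˡ-≤-pos 0ℤ _ (+ k)
    {{positive (+<+ (ℕ.>-nonZero⁻¹ k))}}
    (subst₂ _≤ᶻ_ (sym (ℤ.*-zeroʳ (+ k))) expand (⟨,⟩-nonNeg g)))
    where
    open ≡-Reasoning
    G = ∑ f
    g : A → ℤ
    g x = + k * f x + - 1ℤ * G

    ⟨h,G⟩ : ∀ h → ⟨ h , (λ _ → G) ⟩ ≡ G * ∑ h
    ⟨h,G⟩ h = trans (⟨,⟩-comm h (λ _ → G)) (⟨,⟩-constˡ G h)

    simplify : ∀ k G s →
      k * (k * s + - 1ℤ * (G * G)) + - 1ℤ * (G * (k * G + - 1ℤ * (k * G))) ≡
      k * (k * s - G * G)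
    simplify = solve-∀

    expand : ⟨ g , g ⟩ ≡ + k * (+ k * ⟨ f , f ⟩ - G * G)
    expand = begin
      ⟨ g , g ⟩
        ≡⟨ ⟨,⟩-linearˡ g (+ k) (- 1ℤ) f (λ _ → G) ⟩
      + k * ⟨ f , g ⟩ + - 1ℤ * ⟨ (λ _ → G) , g ⟩
        ≡⟨ cong₂ (λ s t → + k * s + - 1ℤ * t)
             (trans (⟨,⟩-linearʳ f (+ k) (- 1ℤ) f (λ _ → G))
                    (cong (λ t → + k * ⟨ f , f ⟩ + - 1ℤ * t) (⟨h,G⟩ f)))
             (trans (⟨,⟩-constˡ G g) (cong (G *_)
               (trans (∑-linear (+ k) (- 1ℤ) f (λ _ → G))
                      (cong (λ t → + k * G + - 1ℤ * t) (∑-const G))))) ⟩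
      + k * (+ k * ⟨ f , f ⟩ + - 1ℤ * (G * G)) +
        - 1ℤ * (G * (+ k * G + - 1ℤ * (+ k * G)))
        ≡⟨ simplify (+ k) G ⟨ f , f ⟩ ⟩
      + k * (+ k * ⟨ f , f ⟩ - G * G) ∎

opaque
  unfolding FiniteSum.∑

  ∑-swap : ∀ {A B : Set} {k l} (A↔ : A ↔ Fin k) (B↔ : B ↔ Fin l) (h : A → B → ℤ) →
           FiniteSum.∑ A↔ (λ x → FiniteSum.∑ B↔ (h x)) ≡
           FiniteSum.∑ B↔ (λ y → FiniteSum.∑ A↔ (λ x → h x y))
  ∑-swap A↔ B↔ h = ∑-comm (λ i j → h (Inverse.from A↔ i) (Inverse.from B↔ j))

-- Line sums and their functional calculus.

Δ : (ℕ → ℤ) → ℕ → ℤ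
Δ φ z = φ (suc z) - φ z

module Averaging {q : ℕ} (F : FiniteField q) (n : ℕ) where

  open PhaseRotation F
  private module F where
    open FiniteField F public
    open CommutativeRing commutativeRing public
      using (ring; +-assoc; +-comm; +-identityˡ; +-identityʳ; -‿inverseˡ; -‿inverseʳ)
    open import Algebra.Properties.Ring ring public using (-‿involutive)

  V : Set
  V = Vec F.Carrier n

  open FiniteSum F.enumeration public using () renaming
    ( ∑ to ∑ᶠ; ∑-cong to ∑ᶠ-cong; ∑-const to ∑ᶠ-const; ∑-linear to ∑ᶠ-linear
    ; ∑-*ˡ to ∑ᶠ-*ˡ; ∑-reindex to ∑ᶠ-reindex; ∑-single to ∑ᶠ-single)
  open FiniteSum (Vec↔Fin F.enumeration n) public

  Q : ℤ
  Q = + q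

  opaque
    lineSum : V → (V → ℤ) → V → ℤ
    lineSum g f x = ∑ᶠ λ a → f (x +ᵛ a ·ᵛ g)

    lineSum-∑ : ∀ g f x → lineSum g f x ≡ ∑ᶠ λ a → f (x +ᵛ a ·ᵛ g)
    lineSum-∑ g f x = refl

    lineSum-cong : ∀ g {f h} → f ≗ h → lineSum g f ≗ lineSum g h
    lineSum-cong g f≗h x = ∑ᶠ-cong λ a → f≗h (x +ᵛ a ·ᵛ g)

    lineSum-const : ∀ g c x → lineSum g (λ _ → c) x ≡ Q * c
    lineSum-const g c x = ∑ᶠ-const c

    lineSum-*ˡ : ∀ g c f x → lineSum g (λ y → c * f y) x ≡ c * lineSum g f x
    lineSum-*ˡ g c f x = ∑ᶠ-*ˡ c _

    lineSum-linear : ∀ g a b f h x → lineSum g (λ y → a * f y + b * h y) x ≡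
                     a * lineSum g f x + b * lineSum g h x
    lineSum-linear g a b f h x = ∑ᶠ-linear a b _ _

  +ᵛ-·ᵛ-+ᵛ-·ᵛ : ∀ x a b (g : V) → x +ᵛ a ·ᵛ g +ᵛ b ·ᵛ g ≡ x +ᵛ (a F.+ b) ·ᵛ g
  +ᵛ-·ᵛ-+ᵛ-·ᵛ x a b g =
    trans (+ᵛ-assoc x _ _) (cong (x +ᵛ_) (sym (·ᵛ-distribʳ a b g)))

  +ᵛ-0·ᵛ : ∀ (x g : V) → x +ᵛ F.0# ·ᵛ g ≡ x
  +ᵛ-0·ᵛ x g = trans (cong (x +ᵛ_) (·ᵛ-zeroˡ g)) (Vec.zipWith-identityʳ F.+-identityʳ x)

  shift-inverse : ∀ g a b → a F.+ b ≡ F.0# → ∀ (x : V) → x +ᵛ a ·ᵛ g +ᵛ b ·ᵛ g ≡ x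
  shift-inverse g a b a+b≡0 x = trans (+ᵛ-·ᵛ-+ᵛ-·ᵛ x a b g)
    (trans (cong (λ c → x +ᵛ c ·ᵛ g) a+b≡0) (+ᵛ-0·ᵛ x g))

  opaque
    unfolding lineSum

    lineSum-comm : ∀ g h f x → lineSum g (lineSum h f) x ≡ lineSum h (lineSum g f) x
    lineSum-comm g h f x = trans
      (∑-swap F.enumeration F.enumeration (λ a b → f (x +ᵛ a ·ᵛ g +ᵛ b ·ᵛ h)))
      (∑ᶠ-cong λ b → ∑ᶠ-cong λ a → cong f (begin
        (x +ᵛ a ·ᵛ g) +ᵛ b ·ᵛ h    ≡⟨ +ᵛ-assoc x _ _ ⟩
        x +ᵛ (a ·ᵛ g +ᵛ b ·ᵛ h)    ≡⟨ cong (x +ᵛ_) (+ᵛ-comm _ _) ⟩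
        x +ᵛ (b ·ᵛ h +ᵛ a ·ᵛ g)    ≡⟨ +ᵛ-assoc x _ _ ⟨
        (x +ᵛ b ·ᵛ h) +ᵛ a ·ᵛ g    ∎))
      where open ≡-Reasoning

    -- Translating a line along itself only permutes its points, so all `q` inner sums agree.
    lineSum-idem : ∀ g f x → lineSum g (lineSum g f) x ≡ Q * lineSum g f x
    lineSum-idem g f x = trans (∑ᶠ-cong inner) (∑ᶠ-const (lineSum g f x))
      where
      open ≡-Reasoning
      cancel : ∀ a b c → a F.+ b ≡ F.0# → a F.+ (b F.+ c) ≡ c
      cancel a b c eq = trans (sym (F.+-assoc a b c))
        (trans (cong (F._+ c) eq) (F.+-identityˡ c))

      inner : ∀ a → lineSum g f (x +ᵛ a ·ᵛ g) ≡ lineSum g f x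
      inner a = begin
        (∑ᶠ λ b → f (x +ᵛ a ·ᵛ g +ᵛ b ·ᵛ g))  ≡⟨ ∑ᶠ-cong (λ b → cong f (+ᵛ-·ᵛ-+ᵛ-·ᵛ x a b g)) ⟩
        (∑ᶠ λ b → f (x +ᵛ (a F.+ b) ·ᵛ g))    ≡⟨ ∑ᶠ-reindex (a F.+_) (F.- a F.+_)
                                                   (λ b → cancel a _ b (F.-‿inverseʳ a))
                                                   (λ b → cancel _ a b (F.-‿inverseˡ a)) _ ⟨
        lineSum g f x                         ∎

    -- The adjoint of translation by `a ·ᵛ g` is translation by its negative, and the sum over all
    -- `a` is invariant under the change of sign.
    lineSum-adjoint : ∀ g f h → ⟨ f , lineSum g h ⟩ ≡ ⟨ lineSum g f , h ⟩
    lineSum-adjoint g f h = begin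
      ⟨ f , lineSum g h ⟩
        ≡⟨ ⟨,⟩-∑ f _ ⟩
      (∑ λ x → f x * ∑ᶠ λ a → h (x +ᵛ a ·ᵛ g))
        ≡⟨ ∑-cong (λ x → ∑ᶠ-*ˡ (f x) _) ⟨
      (∑ λ x → ∑ᶠ λ a → f x * h (x +ᵛ a ·ᵛ g))
        ≡⟨ ∑-swap Vec↔ F.enumeration (λ x a → f x * h (x +ᵛ a ·ᵛ g)) ⟩
      (∑ᶠ λ a → ∑ λ x → f x * h (x +ᵛ a ·ᵛ g))
        ≡⟨ ∑ᶠ-cong translate ⟩
      (∑ᶠ λ a → ∑ λ x → f (x +ᵛ (F.- a) ·ᵛ g) * h x)
        ≡⟨ ∑ᶠ-reindex F.-_ F.-_ F.-‿involutive F.-‿involutive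
             (λ a → ∑ λ x → f (x +ᵛ a ·ᵛ g) * h x) ⟨
      (∑ᶠ λ a → ∑ λ x → f (x +ᵛ a ·ᵛ g) * h x)
        ≡⟨ ∑-swap Vec↔ F.enumeration (λ x a → f (x +ᵛ a ·ᵛ g) * h x) ⟨
      (∑ λ x → ∑ᶠ λ a → f (x +ᵛ a ·ᵛ g) * h x)
        ≡⟨ ∑-cong (λ x → trans (∑ᶠ-cong λ a → ℤ.*-comm (f (x +ᵛ a ·ᵛ g)) (h x))
             (trans (∑ᶠ-*ˡ (h x) _) (ℤ.*-comm (h x) (lineSum g f x)))) ⟩
      (∑ λ x → lineSum g f x * h x)
        ≡⟨ ⟨,⟩-∑ _ h ⟨
      ⟨ lineSum g f , h ⟩ ∎
      where
      open ≡-Reasoning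
      Vec↔ : V ↔ Fin (q ℕ.^ n)
      Vec↔ = Vec↔Fin F.enumeration n

      translate : ∀ a → (∑ λ x → f x * h (x +ᵛ a ·ᵛ g)) ≡
                        (∑ λ x → f (x +ᵛ (F.- a) ·ᵛ g) * h x)
      translate a = trans
        (∑-reindex (λ x → x +ᵛ (F.- a) ·ᵛ g) (λ x → x +ᵛ a ·ᵛ g)
          (shift-inverse g a (F.- a) (F.-‿inverseʳ a))
          (shift-inverse g (F.- a) a (F.-‿inverseˡ a)) _)
        (∑-cong λ x → cong (λ y → f (x +ᵛ (F.- a) ·ᵛ g) * h y)
          (shift-inverse g (F.- a) a (F.-‿inverseˡ a) x))

  -- Self-adjointness moves the line sum onto the constant function 1, which it multiplies by `q`.
  ∑-lineSum : ∀ g f → ∑ (lineSum g f) ≡ Q * ∑ f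
  ∑-lineSum g f = begin
    ∑ (lineSum g f)                    ≡⟨ ℤ.*-identityˡ _ ⟨
    1ℤ * ∑ (lineSum g f)               ≡⟨ ⟨,⟩-constˡ 1ℤ _ ⟨
    ⟨ (λ _ → 1ℤ) , lineSum g f ⟩       ≡⟨ lineSum-adjoint g _ f ⟩
    ⟨ lineSum g (λ _ → 1ℤ) , f ⟩       ≡⟨ ⟨,⟩-cong (lineSum-const g 1ℤ) (λ _ → refl) ⟩
    ⟨ (λ _ → Q * 1ℤ) , f ⟩             ≡⟨ ⟨,⟩-constˡ (Q * 1ℤ) f ⟩
    Q * 1ℤ * ∑ f                       ≡⟨ cong (_* ∑ f) (ℤ.*-identityʳ Q) ⟩
    Q * ∑ f                            ∎
    where open ≡-Reasoning

  -- With P g = q⁻¹ lineSum g this is q ^ (length gs) φ(∑ P g), because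
  -- φ(P + B) = φ(B) + P (Δ φ)(B) for a projection P commuting with B.
  Φ : List V → (ℕ → ℤ) → (V → ℤ) → V → ℤ
  Φ []       φ f x = φ 0 * f x
  Φ (g ∷ gs) φ f x = Q * Φ gs φ f x + 1ℤ * Φ gs (Δ φ) (lineSum g f) x

  Φ-cong : ∀ gs φ {f h} → f ≗ h → Φ gs φ f ≗ Φ gs φ h
  Φ-cong []       φ f≗h x = cong (φ 0 *_) (f≗h x)
  Φ-cong (g ∷ gs) φ f≗h x = cong₂ (λ s t → Q * s + 1ℤ * t)
    (Φ-cong gs φ f≗h x) (Φ-cong gs (Δ φ) (lineSum-cong g f≗h) x)

  Φ-linear : ∀ gs φ a b f h x →
             Φ gs φ (λ y → a * f y + b * h y) x ≡ a * Φ gs φ f x + b * Φ gs φ h x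
  Φ-linear []       φ a b f h x = distrib (φ 0) a b (f x) (h x)
    where
    distrib : ∀ c a b f g → c * (a * f + b * g) ≡ a * (c * f) + b * (c * g)
    distrib = solve-∀
  Φ-linear (g ∷ gs) φ a b f h x = trans
    (cong₂ (λ s t → Q * s + 1ℤ * t) (Φ-linear gs φ a b f h x)
      (trans (Φ-cong gs (Δ φ) (lineSum-linear g a b f h) x)
             (Φ-linear gs (Δ φ) a b _ _ x)))
    (interchange Q a b _ _ _ _)
    where
    interchange : ∀ Q a b s t u v → Q * (a * s + b * t) + 1ℤ * (a * u + b * v) ≡
                  a * (Q * s + 1ℤ * u) + b * (Q * t + 1ℤ * v)
    interchange = solve-∀

  Φ-*ˡ : ∀ gs φ a f x → Φ gs φ (λ y → a * f y) x ≡ a * Φ gs φ f x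
  Φ-*ˡ gs φ a f x = begin
    Φ gs φ (λ y → a * f y) x                ≡⟨ Φ-cong gs φ (λ y → pad a (f y)) x ⟩
    Φ gs φ (λ y → a * f y + 0ℤ * f y) x     ≡⟨ Φ-linear gs φ a 0ℤ f f x ⟩
    a * Φ gs φ f x + 0ℤ * Φ gs φ f x        ≡⟨ pad a (Φ gs φ f x) ⟨
    a * Φ gs φ f x                          ∎
    where
    open ≡-Reasoning
    pad : ∀ a s → a * s ≡ a * s + 0ℤ * s
    pad = solve-∀

  lineSum-Φ : ∀ g gs φ f x → lineSum g (Φ gs φ f) x ≡ Φ gs φ (lineSum g f) x
  lineSum-Φ g []       φ f x = lineSum-*ˡ g (φ 0) f x
  lineSum-Φ g (h ∷ gs) φ f x = trans (lineSum-linear g Q 1ℤ _ _ x)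
    (cong₂ (λ s t → Q * s + 1ℤ * t) (lineSum-Φ g gs φ f x)
      (trans (lineSum-Φ g gs (Δ φ) (lineSum h f) x)
             (Φ-cong gs (Δ φ) (lineSum-comm g h f) x)))

  -- `Φ` is additive in its function argument, and `φ ∘ suc` is `φ` plus `Δ φ`. The shift by `suc`
  -- appears on the range of a projection, which adds 1 to the eigenvalue of the remaining sum.
  Φ-suc : ∀ gs φ f x → Φ gs (φ ∘ suc) f x ≡ 1ℤ * Φ gs φ f x + 1ℤ * Φ gs (Δ φ) f x
  Φ-suc []       φ f x = step (φ 0) (φ 1) (f x)
    where
    step : ∀ a b f → b * f ≡ 1ℤ * (a * f) + 1ℤ * ((b - a) * f)
    step = solve-∀
  Φ-suc (g ∷ gs) φ f x = trans
    (cong₂ (λ s t → Q * s + 1ℤ * t) (Φ-suc gs φ f x) (Φ-suc gs (Δ φ) (lineSum g f) x))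
    (interchange Q _ _ _ _)
    where
    interchange : ∀ Q s t u v → Q * (1ℤ * s + 1ℤ * t) + 1ℤ * (1ℤ * u + 1ℤ * v) ≡
                  1ℤ * (Q * s + 1ℤ * u) + 1ℤ * (Q * t + 1ℤ * v)
    interchange = solve-∀

  -- f splits orthogonally into P g f and f - P g f, on which P g is 1 and 0.
  Φ-split : ∀ g gs φ f → let u = lineSum g f; v = λ x → Q * f x + - 1ℤ * u x in
            Q * ⟨ f , Φ (g ∷ gs) φ f ⟩ ≡
            ⟨ u , Φ gs (φ ∘ suc) u ⟩ + ⟨ v , Φ gs φ v ⟩
  Φ-split g gs φ f = begin
    Q * ⟨ f , Φ (g ∷ gs) φ f ⟩
      ≡⟨ cong (Q *_) (⟨,⟩-linearʳ f Q 1ℤ A C) ⟩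
    Q * (Q * ⟨ f , A ⟩ + 1ℤ * ⟨ f , C ⟩)
      ≡⟨ rearrange Q ⟨ f , A ⟩ ⟨ f , B ⟩ ⟨ f , C ⟩ ⟩
    (1ℤ * (Q * ⟨ f , B ⟩) + 1ℤ * (Q * ⟨ f , C ⟩)) +
    (Q * (Q * ⟨ f , A ⟩ + - 1ℤ * ⟨ f , B ⟩) +
     - 1ℤ * (Q * ⟨ f , B ⟩ + - 1ℤ * (Q * ⟨ f , B ⟩)))
      ≡⟨ cong₂ _+_
           (cong₂ (λ s t → 1ℤ * s + 1ℤ * t) (⟨u,Φu⟩ φ) (⟨u,Φu⟩ (Δ φ)))
           (cong₂ (λ s t → Q * s + - 1ℤ * t)
             (⟨,⟩-linearʳ f Q (- 1ℤ) A B)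
             (trans (⟨,⟩-linearʳ u Q (- 1ℤ) A B)
               (cong₂ (λ s t → Q * s + - 1ℤ * t) ⟨u,A⟩ (⟨u,Φu⟩ φ)))) ⟨
    (1ℤ * ⟨ u , B ⟩ + 1ℤ * ⟨ u , C ⟩) + (Q * ⟨ f , Av ⟩ + - 1ℤ * ⟨ u , Av ⟩)
      ≡⟨ cong₂ _+_ (⟨,⟩-linearʳ u 1ℤ 1ℤ B C) (⟨,⟩-linearˡ Av Q (- 1ℤ) f u) ⟨
    ⟨ u , (λ x → 1ℤ * B x + 1ℤ * C x) ⟩ + ⟨ v , Av ⟩
      ≡⟨ cong₂ _+_ (⟨,⟩-cong (λ _ → refl) (Φ-suc gs φ u))
                   (⟨,⟩-cong (λ _ → refl) (Φ-linear gs φ Q (- 1ℤ) f u)) ⟨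
    ⟨ u , Φ gs (φ ∘ suc) u ⟩ + ⟨ v , Φ gs φ v ⟩ ∎
    where
    open ≡-Reasoning
    u v A B C Av : V → ℤ
    u = lineSum g f
    v x = Q * f x + - 1ℤ * u x
    A = Φ gs φ f
    B = Φ gs φ u
    C = Φ gs (Δ φ) u
    Av x = Q * A x + - 1ℤ * B x

    ⟨u,A⟩ : ⟨ u , A ⟩ ≡ ⟨ f , B ⟩
    ⟨u,A⟩ = trans (sym (lineSum-adjoint g f A))
      (⟨,⟩-cong (λ _ → refl) (lineSum-Φ g gs φ f))

    ⟨u,Φu⟩ : ∀ ψ → ⟨ u , Φ gs ψ u ⟩ ≡ Q * ⟨ f , Φ gs ψ u ⟩
    ⟨u,Φu⟩ ψ = begin
      ⟨ u , Φ gs ψ u ⟩                  ≡⟨ lineSum-adjoint g f _ ⟨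
      ⟨ f , lineSum g (Φ gs ψ u) ⟩      ≡⟨ ⟨,⟩-cong (λ _ → refl) (λ x → trans
                                             (lineSum-Φ g gs ψ u x)
                                             (Φ-cong gs ψ (lineSum-idem g f) x)) ⟩
      ⟨ f , Φ gs ψ (λ x → Q * u x) ⟩    ≡⟨ ⟨,⟩-cong (λ _ → refl) (Φ-*ˡ gs ψ Q u) ⟩
      ⟨ f , (λ x → Q * Φ gs ψ u x) ⟩    ≡⟨ ⟨,⟩-*ʳ f Q _ ⟩
      Q * ⟨ f , Φ gs ψ u ⟩              ∎

    rearrange : ∀ Q a b c → Q * (Q * a + 1ℤ * c) ≡
      (1ℤ * (Q * b) + 1ℤ * (Q * c)) +
      (Q * (Q * a + - 1ℤ * b) + - 1ℤ * (Q * b + - 1ℤ * (Q * b)))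
    rearrange = solve-∀

  lineSums : List V → (V → ℤ) → V → ℤ
  lineSums []       f = f
  lineSums (g ∷ gs) f = lineSums gs (lineSum g f)

  ∑-lineSums : ∀ gs f → ∑ (lineSums gs f) ≡ Q ^ᶻ length gs * ∑ f
  ∑-lineSums []       f = sym (ℤ.*-identityˡ _)
  ∑-lineSums (g ∷ gs) f = begin
    ∑ (lineSums gs (lineSum g f))        ≡⟨ ∑-lineSums gs (lineSum g f) ⟩
    Q ^ᶻ length gs * ∑ (lineSum g f)     ≡⟨ cong (Q ^ᶻ length gs *_) (∑-lineSum g f) ⟩
    Q ^ᶻ length gs * (Q * ∑ f)           ≡⟨ swap (Q ^ᶻ length gs) Q (∑ f) ⟩
    Q * Q ^ᶻ length gs * ∑ f             ∎
    where
    open ≡-Reasoning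
    swap : ∀ p q s → p * (q * s) ≡ q * p * s
    swap = solve-∀

  -- The eigenvalue `length gs` belongs to the joint range of all projections, onto which
  -- `lineSums gs` projects up to scale; the other joint eigenspaces contribute nonnegatively
  -- because `φ` does. In the induction through `Φ-split` the part `u` carries the estimate. Both
  -- sides are scaled by `q` to the power `2 * length gs`.
  Φ-lowerBound : ∀ gs φ → (∀ z → 0ℤ ≤ᶻ φ z) → ∀ f →
                 φ (length gs) * ⟨ lineSums gs f , lineSums gs f ⟩ ≤ᶻ
                 Q ^ᶻ length gs * ⟨ f , Φ gs φ f ⟩
  Φ-lowerBound []       φ 0≤φ f = ℤ.≤-reflexive (sym
    (trans (ℤ.*-identityˡ _) (⟨,⟩-*ʳ f (φ 0) f)))
  Φ-lowerBound (g ∷ gs) φ 0≤φ f = begin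
    φ (suc m) * ⟨ U , U ⟩                 ≡⟨ ℤ.+-identityʳ _ ⟨
    φ (suc m) * ⟨ U , U ⟩ + 0ℤ            ≤⟨ ℤ.+-mono-≤
                                               (Φ-lowerBound gs (φ ∘ suc) (0≤φ ∘ suc) u)
                                               (ℤ.≤-trans 0≤φ⟨W,W⟩ (Φ-lowerBound gs φ 0≤φ v)) ⟩
    Q ^ᶻ m * ⟨ u , Φ gs (φ ∘ suc) u ⟩ + Q ^ᶻ m * ⟨ v , Φ gs φ v ⟩
                                          ≡⟨ ℤ.*-distribˡ-+ (Q ^ᶻ m) _ _ ⟨
    Q ^ᶻ m * (⟨ u , Φ gs (φ ∘ suc) u ⟩ + ⟨ v , Φ gs φ v ⟩)
                                          ≡⟨ cong (Q ^ᶻ m *_) (Φ-split g gs φ f) ⟨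
    Q ^ᶻ m * (Q * ⟨ f , Φ (g ∷ gs) φ f ⟩) ≡⟨ swap (Q ^ᶻ m) Q _ ⟩
    Q * Q ^ᶻ m * ⟨ f , Φ (g ∷ gs) φ f ⟩   ∎
    where
    open ℤ.≤-Reasoning
    m = length gs
    u v U W : V → ℤ
    u = lineSum g f
    v x = Q * f x + - 1ℤ * u x
    U = lineSums gs u
    W = lineSums gs v

    -- Of the induction hypothesis for `v`, only the nonnegativity of its lower bound is kept.
    0≤φ⟨W,W⟩ : 0ℤ ≤ᶻ φ m * ⟨ W , W ⟩
    0≤φ⟨W,W⟩ = subst (_≤ᶻ φ m * ⟨ W , W ⟩) (ℤ.*-zeroʳ (φ m))
      (ℤ.*-monoˡ-≤-nonNeg (φ m) {{nonNegative (0≤φ m)}} (⟨,⟩-nonNeg W))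

    swap : ∀ p q s → p * (q * s) ≡ q * p * s
    swap = solve-∀

-- Linear independence of the generators, and walks.

fresh : ∀ {n} (is : List (Fin n)) → length is ℕ.< n → ∃[ l ] All (l ≢_) is
fresh {n} is |is|<n with Fin.any? (λ l → All.all? (λ i → ¬? (l Fin.≟ i)) is)
... | yes fresh  = fresh
-- Pigeonhole: if every `l` occurred in `is`, its position there would inject `Fin n` into a smaller
-- set.
... | no  ¬fresh = contradiction
  (Fin.injective⇒≤ {f = λ l → Any.index (occurs l)}
    (λ {l} {l′} eq → trans (Any.lookup-index (occurs l))
      (trans (cong (lookup is) eq) (sym (Any.lookup-index (occurs l′))))))
  (ℕ.<⇒≱ |is|<n)
  where
  occurs : ∀ l → l ∈ₗ is
  occurs l with ∈ₗ? Fin._≟_ l is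
  ... | yes l∈ = l∈
  ... | no  l∉ = contradiction (l , All.tabulate λ { i∈ refl → l∉ i∈ }) ¬fresh

∈⇒∣∣≢0 : ∀ {m} {I : Subset m} {i} → i ∈ I → ∣ I ∣ ≢ 0
∈⇒∣∣≢0 here                    = λ ()
∈⇒∣∣≢0 (there {y = true}  i∈I) = λ ()
∈⇒∣∣≢0 (there {y = false} i∈I) = ∈⇒∣∣≢0 i∈I

module Separation {q : ℕ} (F : FiniteField q) {n : ℕ} where

  open PhaseRotation F hiding (G-pr)
  open FiniteField F using (Carrier; isHeytingField; _≟_) renaming
    (_+_ to _⊕_; _*_ to _⊛_; -_ to ⊖_; 0# to 𝟎; 1# to 𝟏)
  open CommutativeRing (FiniteField.commutativeRing F) using
    (ring; +-identityˡ; +-identityʳ; -‿inverseʳ; zeroʳ; distribˡ;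
     +-assoc; +-comm; -‿inverseˡ)
  open import Algebra.Properties.Ring ring using (-‿+-comm; -‿distribʳ-*; -0#≈0#; -‿involutive)

  private
    heyting : HeytingCommutativeRing _ _ _
    heyting = record { isHeytingCommutativeRing =
      IsHeytingField.isHeytingCommutativeRing isHeytingField }

  open Heyting heyting using (1#0; x#0y#0→xy#0)

  V : Set
  V = Vec Carrier n

  Index : Set
  Index = Fin (suc n)

  -- Homogeneous coordinates: Fⁿ is the quotient of Fⁿ⁺¹ by the all-ones
  -- vector, with the coordinate of index zero normalised to 0, and generator
  -- zero is minus the class of the standard basis vector of index zero.
  coordinate : Index → V → Carrier
  coordinate zero    x = 𝟎
  coordinate (suc i) x = Vec.lookup x i

  -- Differences of homogeneous coordinates are unchanged by adding multiples of the all-ones vector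
  -- of Fⁿ⁺¹, so they are the natural functionals on the quotient. This one vanishes on every
  -- generator other than those of index `k` and `l`, which makes it a test for linear independence.
  separate : Index → Index → V → Carrier
  separate k l x = coordinate k x ⊕ ⊖ coordinate l x

  coordinate-+· : ∀ k x a (g : V) →
    coordinate k (x +ᵛ a ·ᵛ g) ≡ coordinate k x ⊕ a ⊛ coordinate k g
  coordinate-+· zero    x a g = sym (trans (+-identityˡ _) (zeroʳ a))
  coordinate-+· (suc k) x a g = trans (Vec.lookup-zipWith _⊕_ k x (a ·ᵛ g))
    (cong (Vec.lookup x k ⊕_) (Vec.lookup-map k (a ⊛_) g))

  separate-+· : ∀ k l x a (g : V) →
    separate k l (x +ᵛ a ·ᵛ g) ≡ separate k l x ⊕ a ⊛ separate k l g
  separate-+· k l x a g = begin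
    separate k l (x +ᵛ a ·ᵛ g)
      ≡⟨ cong₂ (λ s t → s ⊕ ⊖ t) (coordinate-+· k x a g) (coordinate-+· l x a g) ⟩
    (xₖ ⊕ a ⊛ gₖ) ⊕ ⊖ (xₗ ⊕ a ⊛ gₗ)
      ≡⟨ cong ((xₖ ⊕ a ⊛ gₖ) ⊕_) (-‿+-comm xₗ (a ⊛ gₗ)) ⟨
    (xₖ ⊕ a ⊛ gₖ) ⊕ (⊖ xₗ ⊕ ⊖ (a ⊛ gₗ))
      ≡⟨ +-assoc xₖ _ _ ⟩
    xₖ ⊕ (a ⊛ gₖ ⊕ (⊖ xₗ ⊕ ⊖ (a ⊛ gₗ)))
      ≡⟨ cong (xₖ ⊕_) (trans (sym (+-assoc _ _ _))
           (trans (cong (_⊕ ⊖ (a ⊛ gₗ)) (+-comm _ _)) (+-assoc _ _ _))) ⟩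
    xₖ ⊕ (⊖ xₗ ⊕ (a ⊛ gₖ ⊕ ⊖ (a ⊛ gₗ)))
      ≡⟨ +-assoc xₖ _ _ ⟨
    (xₖ ⊕ ⊖ xₗ) ⊕ (a ⊛ gₖ ⊕ ⊖ (a ⊛ gₗ))
      ≡⟨ cong ((xₖ ⊕ ⊖ xₗ) ⊕_) (trans (distribˡ a gₖ (⊖ gₗ))
           (cong (a ⊛ gₖ ⊕_) (sym (-‿distribʳ-* a gₗ)))) ⟨
    (xₖ ⊕ ⊖ xₗ) ⊕ a ⊛ (gₖ ⊕ ⊖ gₗ) ∎
    where
    open ≡-Reasoning
    xₖ = coordinate k x
    xₗ = coordinate l x
    gₖ = coordinate k g
    gₗ = coordinate l g

  lookup-𝐞 : ∀ (i : Fin n) → Vec.lookup (𝐞 i) i ≡ 𝟏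
  lookup-𝐞 i = Vec.lookup∘update i 0ᵛ 𝟏

  lookup-𝐞-≢ : ∀ {i j : Fin n} → j ≢ i → Vec.lookup (𝐞 i) j ≡ 𝟎
  lookup-𝐞-≢ {j = j} j≢i = trans (Vec.lookup∘update′ j≢i 0ᵛ 𝟏) (Vec.lookup-replicate j 𝟎)

  -- Up to sign and a multiple of the all-ones vector, `generator i` is a standard basis vector of
  -- Fⁿ⁺¹, and such a vector is constant away from its own index.
  coordinate-≢ : ∀ {k l i : Index} → k ≢ i → l ≢ i →
                 coordinate k (generator i) ≡ coordinate l (generator i)
  coordinate-≢ {zero}  {_}     {zero}  k≢i l≢i = contradiction refl k≢i
  coordinate-≢ {suc k} {zero}  {zero}  k≢i l≢i = contradiction refl l≢i
  coordinate-≢ {suc k} {suc l} {zero}  k≢i l≢i =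
    trans (Vec.lookup-replicate k 𝟏) (sym (Vec.lookup-replicate l 𝟏))
  coordinate-≢ {zero}  {zero}  {suc i} k≢i l≢i = refl
  coordinate-≢ {zero}  {suc l} {suc i} k≢i l≢i = sym (lookup-𝐞-≢ (l≢i ∘ cong suc))
  coordinate-≢ {suc k} {zero}  {suc i} k≢i l≢i = lookup-𝐞-≢ (k≢i ∘ cong suc)
  coordinate-≢ {suc k} {suc l} {suc i} k≢i l≢i =
    trans (lookup-𝐞-≢ (k≢i ∘ cong suc)) (sym (lookup-𝐞-≢ (l≢i ∘ cong suc)))

  separate-≢ : ∀ {k l i} → k ≢ i → l ≢ i → separate k l (generator i) ≡ 𝟎
  separate-≢ {k} {l} {i} k≢i l≢i = trans
    (cong (λ c → coordinate k (generator i) ⊕ ⊖ c) (sym (coordinate-≢ {k} {l} k≢i l≢i)))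
    (-‿inverseʳ _)

  x-0≡x : ∀ x → x ⊕ ⊖ 𝟎 ≡ x
  x-0≡x x = trans (cong (x ⊕_) -0#≈0#) (+-identityʳ x)

  -- The value is minus one when `k` is zero and one otherwise.
  separate≢0 : ∀ {k l} → k ≢ l → separate k l (generator k) ≢ 𝟎
  separate≢0 {zero}  {zero}  k≢l = contradiction refl k≢l
  separate≢0 {zero}  {suc l} k≢l eq = 1#0 (begin
    𝟏                                 ≡⟨ Vec.lookup-replicate l 𝟏 ⟨
    c                                 ≡⟨ -‿involutive c ⟨
    ⊖ (⊖ c)                           ≡⟨ cong ⊖_ (+-identityˡ (⊖ c)) ⟨
    ⊖ (𝟎 ⊕ ⊖ c)                       ≡⟨ cong ⊖_ eq ⟩
    ⊖ 𝟎                               ≡⟨ -0#≈0# ⟩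
    𝟎                                 ∎)
    where
    open ≡-Reasoning
    c = coordinate (suc l) (generator zero)
  separate≢0 {suc k} {l} k≢l eq = 1#0 (begin
    𝟏                                 ≡⟨ lookup-𝐞 k ⟨
    c                                 ≡⟨ x-0≡x c ⟨
    c ⊕ ⊖ 𝟎                           ≡⟨ cong (λ d → c ⊕ ⊖ d) (l-coordinate l k≢l) ⟨
    separate (suc k) l (generator (suc k)) ≡⟨ eq ⟩
    𝟎                                 ∎)
    where
    open ≡-Reasoning
    c = coordinate (suc k) (generator (suc k))
    l-coordinate : ∀ l → suc k ≢ l → coordinate l (generator (suc k)) ≡ 𝟎
    l-coordinate zero    k≢l = refl
    l-coordinate (suc l) k≢l = lookup-𝐞-≢ (k≢l ∘ cong suc ∘ sym)

  separate-shift : ∀ {k l} → k ≢ l → ∀ {a} → a ≢ 𝟎 → ∀ x →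
                   separate k l (x +ᵛ a ·ᵛ generator k) ≢ separate k l x
  separate-shift {k} {l} k≢l {a} a≢0 x eq = x#0y#0→xy#0 a≢0 (separate≢0 k≢l) (begin
    t                  ≡⟨ +-identityˡ t ⟨
    𝟎 ⊕ t              ≡⟨ cong (_⊕ t) (-‿inverseˡ s) ⟨
    (⊖ s ⊕ s) ⊕ t      ≡⟨ +-assoc (⊖ s) s t ⟩
    ⊖ s ⊕ (s ⊕ t)      ≡⟨ cong (⊖ s ⊕_) (separate-+· k l x a (generator k)) ⟨
    ⊖ s ⊕ separate k l (x +ᵛ a ·ᵛ generator k) ≡⟨ cong (⊖ s ⊕_) eq ⟩
    ⊖ s ⊕ s            ≡⟨ -‿inverseˡ s ⟩
    𝟎                  ∎)
    where
    open ≡-Reasoning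
    s = separate k l x
    t = a ⊛ separate k l (generator k)

  infixr 5 _∷_
  data Reach : List Index → V → V → Set where
    []  : ∀ {x} → Reach [] x x
    _∷_ : ∀ {i is x y} a → Reach is (x +ᵛ a ·ᵛ generator i) y → Reach (i ∷ is) x y

  separate-reach : ∀ {k l is x y} → All (k ≢_) is → All (l ≢_) is →
                   Reach is x y → separate k l y ≡ separate k l x
  separate-reach []            []            []      = refl
  separate-reach {k} {l} {i ∷ _} {x} (k≢i ∷ k≢is) (l≢i ∷ l≢is) (a ∷ r) = begin
    separate k l _                              ≡⟨ separate-reach k≢is l≢is r ⟩
    separate k l (x +ᵛ a ·ᵛ generator i)        ≡⟨ separate-+· k l x a (generator i) ⟩
    separate k l x ⊕ a ⊛ separate k l (generator i)
      ≡⟨ cong (λ c → separate k l x ⊕ a ⊛ c) (separate-≢ k≢i l≢i) ⟩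
    separate k l x ⊕ a ⊛ 𝟎                      ≡⟨ cong (separate k l x ⊕_) (zeroʳ a) ⟩
    separate k l x ⊕ 𝟎                          ≡⟨ +-identityʳ _ ⟩
    separate k l x                              ∎
    where open ≡-Reasoning

  open FiniteGraph (G-pr F n) using (_~_; Walk; []; _∷_; ~-sym)

  +ᵛ-identityʳ : ∀ (x : V) → x +ᵛ 0ᵛ ≡ x
  +ᵛ-identityʳ = Vec.zipWith-identityʳ +-identityʳ

  span-empty : ∀ {I : Subset (suc n)} {x} → ∣ I ∣ ≡ 0 → Span (⋃𝐅 I) x → x ≡ 0ᵛ
  span-empty ∣I∣≡0 zero                  = refl
  span-empty ∣I∣≡0 (_ · (_ , i∈I , _) ∷ _) = contradiction ∣I∣≡0 (∈⇒∣∣≢0 i∈I)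

  -- The generator itself gives the upper bound. Weight zero would force the zero vector; since
  -- `1 ≤ n` there is a second index `l`, and `separate i l` takes a nonzero value on the multiple.
  weight-multiple : 1 ≤ n → ∀ i {a} → a ≢ 𝟎 → w-pr (a ·ᵛ generator {n} i) ≡ 1
  weight-multiple 1≤n i {a} a≢0 with weight (a ·ᵛ generator {n} i)
  ... | w , spanned , w≤ = ℕ.≤-antisym
    (w≤ (⁅ i ⁆ , ∣⁅x⁆∣≡1 i , subst (Span (⋃𝐅 ⁅ i ⁆)) (+ᵛ-identityʳ _)
      (a · (i , x∈⁅x⁆ i , generator∈𝐅 i) ∷ zero)))
    (ℕ.n≢0⇒n>0 λ { refl → nonzero (span-empty (proj₁ (proj₂ spanned)) (proj₂ (proj₂ spanned))) })
    where
    nonzero : a ·ᵛ generator i ≢ 0ᵛ {n}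
    nonzero eq with fresh (i ∷ []) (s≤s 1≤n)
    ... | l , l≢i ∷ [] = separate-shift (l≢i ∘ sym) a≢0 0ᵛ
      (cong (separate i l) (trans (+ᵛ-identityˡ _) eq))

  adjacent : 1 ≤ n → ∀ i {a} → a ≢ 𝟎 → ∀ (x : V) → x ~ x +ᵛ a ·ᵛ generator i
  adjacent 1≤n i {a} a≢0 x = ~-sym {x = x +ᵛ a ·ᵛ generator i} {y = x}
    (trans (cong w-pr difference) (weight-multiple 1≤n i a≢0))
    where
    open ≡-Reasoning
    g = a ·ᵛ generator i
    difference : (x +ᵛ g) -ᵛ x ≡ g
    difference = begin
      (x +ᵛ g) -ᵛ x         ≡⟨ cong (_-ᵛ x) (+ᵛ-comm x g) ⟩
      (g +ᵛ x) -ᵛ x         ≡⟨ +ᵛ-assoc g x (negᵛ x) ⟩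
      g +ᵛ (x -ᵛ x)         ≡⟨ cong (g +ᵛ_) (+ᵛ-inverseʳ x) ⟩
      g +ᵛ 0ᵛ               ≡⟨ +ᵛ-identityʳ g ⟩
      g                     ∎

  -- A nonzero coefficient gives an edge and a zero coefficient gives none, hence only an inequality
  -- for the length.
  walk : 1 ≤ n → ∀ {is x y} → Reach is x y → ∃[ l ] Walk x y l × l ≤ length is
  walk 1≤n []      = 0 , [] , z≤n
  walk 1≤n {i ∷ _} {x} {y} (a ∷ r) with walk 1≤n r | a ≟ 𝟎
  ... | l , w , l≤ | no  a≢0  = suc l , adjacent 1≤n i a≢0 x ∷ w , s≤s l≤
  ... | l , w , l≤ | yes refl =
    l , subst (λ z → Walk z y l) (Averaging.+ᵛ-0·ᵛ F n x (generator i)) w ,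
    ℕ.≤-trans l≤ (ℕ.n≤1+n _)

-- Finite differences and the cubic.

-- A function on ℕ is a polynomial of degree below `d` exactly when its `d`-th forward difference
-- vanishes. This form matches the recursion of `Φ`, which replaces `φ` by `Δ φ`.
Degree< : ℕ → (ℕ → ℤ) → Set
Degree< zero    φ = ∀ z → φ z ≡ 0ℤ
Degree< (suc d) φ = Degree< d (Δ φ)

Δ-zero : ∀ {φ} → (∀ z → φ z ≡ 0ℤ) → ∀ z → Δ φ z ≡ 0ℤ
Δ-zero φ≡0 z = cong₂ _-_ (φ≡0 (suc z)) (φ≡0 z)

-- This is ∑ₖ (m choose k) Q ^ (m - k) Δᵏ φ(0), the diagonal entry of Φ for m
-- generators, since a product of distinct line sums has diagonal entry 1.
newton : ℤ → ℕ → (ℕ → ℤ) → ℤ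
newton Q zero    φ = φ 0
newton Q (suc m) φ = Q * newton Q m φ + 1ℤ * newton Q m (Δ φ)

newton-zero : ∀ Q m {φ} → (∀ z → φ z ≡ 0ℤ) → newton Q m φ ≡ 0ℤ
newton-zero Q zero    φ≡0 = φ≡0 0
newton-zero Q (suc m) φ≡0 = trans
  (cong₂ (λ s t → Q * s + 1ℤ * t) (newton-zero Q m φ≡0) (newton-zero Q m (Δ-zero φ≡0)))
  (vanish Q)
  where
  vanish : ∀ Q → Q * 0ℤ + 1ℤ * 0ℤ ≡ 0ℤ
  vanish = solve-∀

-- Only the binomials up to m choose 3 survive, and Pascal's rule drives the induction. The factor 6
-- clears their denominators, and the cube of `Q` lets the full power `Q ^ᶻ m` be taken out even for
-- small `m`.
newton-cubic : ∀ Q m φ → Degree< 4 φ →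
  + 6 * (Q * Q * Q) * newton Q m φ ≡
  Q ^ᶻ m * (+ 6 * (Q * Q * Q) * φ 0 + + 6 * (Q * Q) * + m * Δ φ 0 +
            + 3 * Q * + m * (+ m - 1ℤ) * Δ (Δ φ) 0 +
            + m * (+ m - 1ℤ) * (+ m - + 2) * Δ (Δ (Δ φ)) 0)
newton-cubic Q zero φ deg = base Q (φ 0) (Δ φ 0) (Δ (Δ φ) 0) (Δ (Δ (Δ φ)) 0)
  where
  base : ∀ Q a b c d →
    + 6 * (Q * Q * Q) * a ≡
    1ℤ * (+ 6 * (Q * Q * Q) * a + + 6 * (Q * Q) * + 0 * b +
          + 3 * Q * + 0 * (+ 0 - 1ℤ) * c + + 0 * (+ 0 - 1ℤ) * (+ 0 - + 2) * d)
  base = solve-∀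
newton-cubic Q (suc m) φ deg = begin
  + 6 * (Q * Q * Q) * (Q * newton Q m φ + 1ℤ * newton Q m (Δ φ))
    ≡⟨ expand Q _ _ ⟩
  Q * (+ 6 * (Q * Q * Q) * newton Q m φ) + + 6 * (Q * Q * Q) * newton Q m (Δ φ)
    ≡⟨ cong₂ (λ s t → Q * s + t) (newton-cubic Q m φ deg)
         -- The formula for `Δ φ` ends in the fourth difference of `φ` at 0, which `deg 0` replaces
         -- by zero.
         (trans (newton-cubic Q m (Δ φ) (Δ-zero deg))
                (cong (λ e → Q ^ᶻ m * (+ 6 * (Q * Q * Q) * Δ φ 0 +
                    + 6 * (Q * Q) * + m * Δ (Δ φ) 0 +
                    + 3 * Q * + m * (+ m - 1ℤ) * Δ (Δ (Δ φ)) 0 +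
                    + m * (+ m - 1ℤ) * (+ m - + 2) * e)) (deg 0))) ⟩
  _ ≡⟨ step Q (Q ^ᶻ m) (+ m) (φ 0) (Δ φ 0) (Δ (Δ φ) 0) (Δ (Δ (Δ φ)) 0) ⟩
  _ ∎
  where
  open ≡-Reasoning
  expand : ∀ Q s t → + 6 * (Q * Q * Q) * (Q * s + 1ℤ * t) ≡
                     Q * (+ 6 * (Q * Q * Q) * s) + + 6 * (Q * Q * Q) * t
  expand = solve-∀
  step : ∀ Q P m a b c d →
    Q * (P * (+ 6 * (Q * Q * Q) * a + + 6 * (Q * Q) * m * b +
              + 3 * Q * m * (m - 1ℤ) * c + m * (m - 1ℤ) * (m - + 2) * d)) +
    P * (+ 6 * (Q * Q * Q) * b + + 6 * (Q * Q) * m * c +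
         + 3 * Q * m * (m - 1ℤ) * d + m * (m - 1ℤ) * (m - + 2) * 0ℤ) ≡
    Q * P * (+ 6 * (Q * Q * Q) * a + + 6 * (Q * Q) * (1ℤ + m) * b +
         + 3 * Q * (1ℤ + m) * (1ℤ + m - 1ℤ) * c +
         (1ℤ + m) * (1ℤ + m - 1ℤ) * (1ℤ + m - + 2) * d)
  step = solve-∀

-- Up to the factor q³, this is the product (λ - θ₁) (λ - θ₂) (λ - θ₃) at the
-- adjacency eigenvalue λ = q t - (n + 1), whose roots θᵢ are at t = 0, c, c + 1.
cubic : ℤ → ℤ → ℤ
cubic c t = t * (t - c) * (t - c - 1ℤ)

-- The last two factors are consecutive integers, so no integer lies strictly between their roots
-- and their product is never negative.
cubic-nonNeg : ∀ c z → 0ℤ ≤ᶻ cubic c (+ z)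
cubic-nonNeg c z = subst₂ _≤ᶻ_ (ℤ.*-zeroʳ (+ z)) (sym (ℤ.*-assoc (+ z) (+ z - c) _))
  (ℤ.*-monoˡ-≤-nonNeg (+ z) (pronic (+ z - c)))
  where
  pronic : ∀ i → 0ℤ ≤ᶻ i * (i - 1ℤ)
  pronic (+ zero)  = +≤+ z≤n
  pronic (+ suc k) = subst (0ℤ ≤ᶻ_) (ℤ.pos-* (suc k) k) (+≤+ z≤n)
  pronic -[1+ k ]  = +≤+ z≤n

-- The third difference of a monic cubic is the constant 3! = 6.
cubic-degree : ∀ c → Degree< 4 (cubic c ∘ +_)
cubic-degree c z = fourthDifference c (+ z)
  where
  D₁ D₂ D₃ : ℤ → ℤ → ℤ
  D₁ c t = cubic c (1ℤ + t) - cubic c t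
  D₂ c t = D₁ c (1ℤ + t) - D₁ c t
  D₃ c t = D₂ c (1ℤ + t) - D₂ c t
  third : ∀ c t →
    (((1ℤ + (1ℤ + (1ℤ + t))) * (1ℤ + (1ℤ + (1ℤ + t)) - c) * (1ℤ + (1ℤ + (1ℤ + t)) - c - 1ℤ) -
      (1ℤ + (1ℤ + t)) * (1ℤ + (1ℤ + t) - c) * (1ℤ + (1ℤ + t) - c - 1ℤ)) -
     ((1ℤ + (1ℤ + t)) * (1ℤ + (1ℤ + t) - c) * (1ℤ + (1ℤ + t) - c - 1ℤ) -
      (1ℤ + t) * (1ℤ + t - c) * (1ℤ + t - c - 1ℤ))) -
    (((1ℤ + (1ℤ + t)) * (1ℤ + (1ℤ + t) - c) * (1ℤ + (1ℤ + t) - c - 1ℤ) -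
      (1ℤ + t) * (1ℤ + t - c) * (1ℤ + t - c - 1ℤ)) -
     ((1ℤ + t) * (1ℤ + t - c) * (1ℤ + t - c - 1ℤ) -
      t * (t - c) * (t - c - 1ℤ)))
    ≡ + 6
  third = solve-∀
  fourthDifference : ∀ c t → D₃ c (1ℤ + t) - D₃ c t ≡ 0ℤ
  fourthDifference c t = cong₂ _-_ (third c (1ℤ + t)) (third c t)

-- The cubic vanishes at 0, which removes the only Newton term without a factor `n + 1`. That factor
-- also divides the value of the cubic at `n + 1` and cancels in `ratioBound`; what remains becomes
-- the numerator of the bound.
newton-cubic-value : ∀ Q n c →
  + 6 * (Q * Q * Q) * newton Q (suc n) (cubic c ∘ +_) ≡
  Q ^ᶻ suc n * (+ 6 * (1ℤ + + n) *
    (+ n * (+ n + + 2 * Q - 1ℤ) + Q * c * (- + 2 * + n - Q + Q * c)))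
newton-cubic-value Q n c = trans
  (newton-cubic Q (suc n) (cubic c ∘ +_) (cubic-degree c))
  (simplify Q (Q ^ᶻ suc n) (+ n) c)
  where
  simplify : ∀ Q P n c →
    P * (+ 6 * (Q * Q * Q) * (+ 0 * (+ 0 - c) * (+ 0 - c - 1ℤ)) +
         + 6 * (Q * Q) * (1ℤ + n) *
           (+ 1 * (+ 1 - c) * (+ 1 - c - 1ℤ) - + 0 * (+ 0 - c) * (+ 0 - c - 1ℤ)) +
         + 3 * Q * (1ℤ + n) * (1ℤ + n - 1ℤ) *
           ((+ 2 * (+ 2 - c) * (+ 2 - c - 1ℤ) - + 1 * (+ 1 - c) * (+ 1 - c - 1ℤ)) -
            (+ 1 * (+ 1 - c) * (+ 1 - c - 1ℤ) - + 0 * (+ 0 - c) * (+ 0 - c - 1ℤ))) +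
         (1ℤ + n) * (1ℤ + n - 1ℤ) * (1ℤ + n - + 2) *
           (((+ 3 * (+ 3 - c) * (+ 3 - c - 1ℤ) - + 2 * (+ 2 - c) * (+ 2 - c - 1ℤ)) -
             (+ 2 * (+ 2 - c) * (+ 2 - c - 1ℤ) - + 1 * (+ 1 - c) * (+ 1 - c - 1ℤ))) -
            ((+ 2 * (+ 2 - c) * (+ 2 - c - 1ℤ) - + 1 * (+ 1 - c) * (+ 1 - c - 1ℤ)) -
             (+ 1 * (+ 1 - c) * (+ 1 - c - 1ℤ) - + 0 * (+ 0 - c) * (+ 0 - c - 1ℤ))))) ≡
    P * (+ 6 * (1ℤ + n) *
      (n * (n + + 2 * Q - 1ℤ) + Q * c * (- + 2 * n - Q + Q * c)))
  simplify = solve-∀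

pos-^ : ∀ m k → (+ m) ^ᶻ k ≡ + (m ℕ.^ k)
pos-^ m zero    = refl
pos-^ m (suc k) = trans (cong (+ m *_) (pos-^ m k)) (sym (ℤ.pos-* m (m ℕ.^ k)))

-- Diagonal entries of `Φ`.

module Diagonal {q : ℕ} (F : FiniteField q) {n : ℕ} where

  open Averaging F n
  open Separation F {n} using (Index; Reach; []; _∷_; separate; separate-shift; separate-reach)
  open PhaseRotation F using (generator)
  open FiniteField F using (0#)

  Φ-zero : ∀ gs {φ} → (∀ z → φ z ≡ 0ℤ) → ∀ f x → Φ gs φ f x ≡ 0ℤ
  Φ-zero []       φ≡0 f x = cong (_* f x) (φ≡0 0)
  Φ-zero (g ∷ gs) φ≡0 f x = trans
    (cong₂ (λ s t → Q * s + 1ℤ * t) (Φ-zero gs φ≡0 f x)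
      (Φ-zero gs (Δ-zero φ≡0) (lineSum g f) x))
    (vanish Q)
    where
    vanish : ∀ Q → Q * 0ℤ + 1ℤ * 0ℤ ≡ 0ℤ
    vanish = solve-∀

  generatorSums : List Index → (V → ℤ) → V → ℤ
  generatorSums is f = foldr (lineSum ∘ generator) f is

  -- The value at `x` is a sum of values of `f` at points reached from `x` along `is`.
  generatorSums-zero : ∀ is f {x} → (∀ {y} → Reach is x y → f y ≡ 0ℤ) →
                       generatorSums is f x ≡ 0ℤ
  generatorSums-zero []       f f≡0 = f≡0 []
  generatorSums-zero (i ∷ is) f {x} f≡0 = begin
    lineSum (generator i) (generatorSums is f) x     ≡⟨ lineSum-∑ (generator i) _ x ⟩
    _                                                ≡⟨ ∑ᶠ-cong (λ a →
                                                          generatorSums-zero is f (f≡0 ∘ (a ∷_))) ⟩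
    ∑ᶠ (λ _ → 0ℤ)                                    ≡⟨ ∑ᶠ-const 0ℤ ⟩
    Q * 0ℤ                                           ≡⟨ ℤ.*-zeroʳ Q ⟩
    0ℤ                                               ∎
    where open ≡-Reasoning

  Isolated : ℕ → (V → ℤ) → V → Set
  Isolated k f x = ∀ {is y} → length is ≤ k → Reach is x y → y ≢ x → f y ≡ 0ℤ

  -- At most `n` distinct generators are linearly independent. Among the `n + 1` indices some `l` is
  -- outside the list, and `separate i l` is altered by a nonzero first step but by no later one, so
  -- such a path never returns to `x` and isolation makes its term zero.
  generatorSums-isolated : ∀ {k f x} → k ≤ n → Isolated k f x →
    ∀ {is} → Unique is → length is ≤ k → generatorSums is f x ≡ f x
  generatorSums-isolated k≤n isolated []       _ = refl
  generatorSums-isolated {k} {f} {x} k≤n isolated {i ∷ is} (i≢is ∷ unique) |is|<k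
    with fresh (i ∷ is) (s≤s (ℕ.≤-trans |is|<k k≤n))
  ... | l , l≢i ∷ l≢is = begin
    lineSum g (generatorSums is f) x       ≡⟨ lineSum-∑ g _ x ⟩
    ∑ᶠ (λ a → generatorSums is f (x +ᵛ a ·ᵛ g)) ≡⟨ ∑ᶠ-single 0# other ⟩
    generatorSums is f (x +ᵛ 0# ·ᵛ g)      ≡⟨ cong (generatorSums is f) (+ᵛ-0·ᵛ x g) ⟩
    generatorSums is f x                   ≡⟨ generatorSums-isolated k≤n isolated unique
                                                (ℕ.<⇒≤ |is|<k) ⟩
    f x                                    ∎
    where
    open ≡-Reasoning
    open PhaseRotation F using (_+ᵛ_; _·ᵛ_)
    g = generator i

    other : ∀ a → a ≢ 0# → generatorSums is f (x +ᵛ a ·ᵛ g) ≡ 0ℤ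
    other a a≢0 = generatorSums-zero is f λ {y} r → isolated {i ∷ is} |is|<k (a ∷ r) λ y≡x →
      separate-shift (l≢i ∘ sym) a≢0 x
        (trans (sym (separate-reach i≢is l≢is r)) (cong (separate i l) y≡x))

  -- Each generator of `is` is either dropped with a factor `q` or moved to `js` while `φ` loses a
  -- degree. The invariant `length js + d ≤ suc k` ensures that `φ` has become zero before `js` can
  -- exceed `k` members, so isolation evaluates every surviving term.
  Φ-diagonal : ∀ {k f x} → k ≤ n → Isolated k f x → f x ≡ 1ℤ →
    ∀ is js φ d → Degree< d φ → length js ℕ.+ d ≤ suc k →
    Unique is → Unique js → All (λ i → All (i ≢_) js) is →
    Φ (map generator is) φ (generatorSums js f) x ≡ newton Q (length is) φ
  Φ-diagonal k≤n isolated fx≡1 is js φ zero φ≡0 _ _ _ _ =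
    trans (Φ-zero (map generator is) φ≡0 _ _) (sym (newton-zero Q (length is) φ≡0))
  Φ-diagonal {x = x} k≤n isolated fx≡1 [] js φ (suc d) deg |js|+d≤ _ uniqueʲ _ = begin
    φ 0 * generatorSums js _ x   ≡⟨ cong (φ 0 *_) (trans
                                      (generatorSums-isolated k≤n isolated uniqueʲ |js|≤k) fx≡1) ⟩
    φ 0 * 1ℤ                     ≡⟨ ℤ.*-identityʳ (φ 0) ⟩
    φ 0                          ∎
    where
    open ≡-Reasoning
    -- The degree bound is still `suc d`, and its one unit leaves room for at most `k` members of
    -- `js`.
    |js|≤k : length js ≤ _
    |js|≤k = ℕ.≤-trans (ℕ.m≤m+n (length js) d)
      (ℕ.≤-pred (ℕ.≤-trans (ℕ.≤-reflexive (sym (ℕ.+-suc (length js) d))) |js|+d≤))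
  Φ-diagonal k≤n isolated fx≡1 (i ∷ is) js φ (suc d) deg |js|+d≤
             (i≢is ∷ uniqueⁱ) uniqueʲ (i≢js ∷ is≢js) =
    cong₂ (λ s t → Q * s + 1ℤ * t)
      (Φ-diagonal k≤n isolated fx≡1 is js φ (suc d) deg |js|+d≤ uniqueⁱ uniqueʲ is≢js)
      (Φ-diagonal k≤n isolated fx≡1 is (i ∷ js) (Δ φ) d deg
        (ℕ.≤-trans (ℕ.≤-reflexive (sym (ℕ.+-suc (length js) d))) |js|+d≤)
        uniqueⁱ (i≢js ∷ uniqueʲ)
        (All.zipWith (λ (i≢j , j≢js) → i≢j ∘ sym ∷ j≢js) (i≢is , is≢js)))

-- The integer inequality for a 3-independent set.

module Ratio {q : ℕ} .{{q≢0 : NonZero q}} (F : FiniteField q) {n : ℕ} (3≤n : 3 ≤ n) where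

  open Averaging F n
  open Diagonal F {n}
  open Separation F {n} using (walk)
  open PhaseRotation F using (generator)
  open FiniteGraph (G-pr F n) using (index; Independent; VertexSet)

  instance
    qⁿ≢0 : NonZero (q ℕ.^ n)
    qⁿ≢0 = ℕ.m^n≢0 q n

  1≤n : 1 ≤ n
  1≤n = ℕ.≤-trans (s≤s z≤n) 3≤n

  generators : List V
  generators = map generator (allFin (suc n))

  length-allFin : length (allFin (suc n)) ≡ suc n
  length-allFin = List.length-tabulate {n = suc n} (λ i → i)

  length-generators : length generators ≡ suc n
  length-generators = trans (List.length-map generator (allFin (suc n))) length-allFin

  characteristic : VertexSet → V → ℤ
  characteristic S x = indicator (Vec.lookup S (index x))

  -- Three or fewer generator steps make a walk of length at most 3, and independence forbids such a
  -- walk between distinct members of `S`.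
  characteristic-isolated : ∀ S → Independent 3 S → ∀ {x} → Vec.lookup S (index x) ≡ true →
                            Isolated 3 (characteristic S) x
  characteristic-isolated S independent {x} x∈S {y = y} |is|≤3 r y≢x
    with Vec.lookup S (index y) in y∈S
  ... | false = refl
  ... | true  with walk 1≤n r
  ...   | l , w , l≤|is| = contradiction
    (independent x y (Vec.lookup⇒[]= _ S x∈S) (Vec.lookup⇒[]= _ S y∈S) (y≢x ∘ sym) w)
    (ℕ.≤⇒≯ (ℕ.≤-trans l≤|is| |is|≤3))

  -- The factor `f x` restricts the sum to members of `S`, where `Φ-diagonal` gives the same value
  -- at each point.
  Φ-characteristic : ∀ S → Independent 3 S → ∀ φ → Degree< 4 φ →
    let f = characteristic S in
    ⟨ f , Φ generators φ f ⟩ ≡ newton Q (suc n) φ * + ∣ S ∣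
  Φ-characteristic S independent φ deg = begin
    ⟨ f , Φ generators φ f ⟩            ≡⟨ ⟨,⟩-∑ f _ ⟩
    ∑ (λ x → f x * Φ generators φ f x)  ≡⟨ ∑-cong diagonal ⟩
    ∑ (λ x → w * f x)                   ≡⟨ ∑-*ˡ w f ⟩
    w * ∑ f                             ≡⟨ cong (w *_) (∑-indicator S) ⟩
    w * + ∣ S ∣                         ∎
    where
    open ≡-Reasoning
    f = characteristic S
    w = newton Q (suc n) φ

    diagonal : ∀ x → f x * Φ generators φ f x ≡ w * f x
    diagonal x with Vec.lookup S (index x) in x∈S
    ... | false = sym (ℤ.*-zeroʳ w)
    ... | true  = trans (ℤ.*-identityˡ _) (trans
      -- With `k = 3`, `d = 4` and `js` empty, the budget `0 + 4 ≤ 4` is met with equality.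
      (Φ-diagonal 3≤n (characteristic-isolated S independent x∈S) (cong indicator x∈S)
        (allFin (suc n)) [] φ 4 deg ℕ.≤-refl (Unique.allFin⁺ (suc n)) []
        (All.tabulate λ _ → []))
      (trans (cong (λ m → newton Q m φ) length-allFin) (sym (ℤ.*-identityʳ w))))

  -- Cauchy-Schwarz for `T` and `Φ-lowerBound` bound the quadratic form from below, and
  -- `Φ-characteristic` evaluates it. The lower bound is quadratic in the size of `S` and the value
  -- is linear, so one copy of the size cancels as part of `X`, which `1 ≤ ∣ S ∣` makes positive.
  -- The factor `K` is the one under which `newton-cubic-value` is integral.
  ratioBound : ∀ S → Independent 3 S → 1 ≤ ∣ S ∣ → ∀ c →
    + ∣ S ∣ * (+ (q ℕ.^ 3) * (+ n - c) * (+ n + 1ℤ - c)) ≤ᶻ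
    + (q ℕ.^ n) * (+ n * (+ n + + 2 * Q - 1ℤ) + Q * c * (- + 2 * + n - Q + Q * c))
  ratioBound S independent 1≤|S| c = subst
    (λ Q³ → s * (Q³ * (+ n - c) * (+ n + 1ℤ - c)) ≤ᶻ N * num)
    (trans (cube Q) (pos-^ q 3))
    (ℤ.*-cancelˡ-≤-pos _ _ X {{positive 0<X}} (begin
      X * (s * (Q * Q * Q * (+ n - c) * (+ n + 1ℤ - c)))
        ≡⟨ expandˡ Q P s (+ n) c ⟩
      K * (φₘ * (P * s * (P * s)))
        ≡⟨ cong (λ t → K * (φₘ * (t * t))) ∑T ⟨
      K * (φₘ * (∑ T * ∑ T))
        ≤⟨ ℤ.*-monoˡ-≤-nonNeg K (ℤ.*-monoˡ-≤-nonNeg φₘ (cauchy-schwarz T)) ⟩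
      K * (φₘ * (N * ⟨ T , T ⟩))
        ≡⟨ cong (K *_) (swap φₘ N ⟨ T , T ⟩) ⟩
      K * (N * (φₘ * ⟨ T , T ⟩))
        ≤⟨ ℤ.*-monoˡ-≤-nonNeg K (ℤ.*-monoˡ-≤-nonNeg N lower) ⟩
      K * (N * (P * (w * s)))
        ≡⟨ regroup K N P w s ⟩
      N * P * s * (K * w)
        ≡⟨ cong (N * P * s *_) (newton-cubic-value Q n c) ⟩
      N * P * s * (P * (+ 6 * (1ℤ + + n) * num))
        ≡⟨ expandʳ N P s (+ n) num ⟩
      X * (N * num) ∎))
    where
    open ℤ.≤-Reasoning
    s N P K X num φₘ w : ℤ
    s = + ∣ S ∣
    N = + (q ℕ.^ n)
    P = Q ^ᶻ suc n
    K = + 6 * (Q * Q * Q)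
    X = + 6 * (1ℤ + + n) * s * (P * P)
    num = + n * (+ n + + 2 * Q - 1ℤ) + Q * c * (- + 2 * + n - Q + Q * c)
    φ : ℕ → ℤ
    φ = cubic c ∘ +_
    φₘ = cubic c (1ℤ + + n)
    w = newton Q (suc n) φ
    f T : V → ℤ
    f = characteristic S
    T = lineSums generators f

    0<Q : 0ℤ < Q
    0<Q = +<+ (ℕ.>-nonZero⁻¹ q)

    0<P : 0ℤ < P
    0<P = subst (0ℤ <_) (sym (pos-^ q (suc n)))
      (+<+ (ℕ.>-nonZero⁻¹ (q ℕ.^ suc n) {{ℕ.m^n≢0 q (suc n)}}))

    0<X : 0ℤ < X
    0<X = pos*pos (pos*pos (pos*pos {+ 6} {1ℤ + + n} (+<+ (s≤s z≤n)) (+<+ (s≤s z≤n))) (+<+ 1≤|S|))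
      (pos*pos 0<P 0<P)

    instance
      K≥0 : NonNegative K
      K≥0 = nonNegative (ℤ.<⇒≤ (pos*pos {+ 6} (+<+ (s≤s z≤n)) (pos*pos (pos*pos 0<Q 0<Q) 0<Q)))

      φₘ≥0 : NonNegative φₘ
      φₘ≥0 = nonNegative (cubic-nonNeg c (suc n))

    -- Each of the `n + 1` line sums multiplies the total by `q`.
    ∑T : ∑ T ≡ P * s
    ∑T = trans (∑-lineSums generators f)
      (cong₂ _*_ (cong (Q ^ᶻ_) length-generators) (∑-indicator S))

    lower : φₘ * ⟨ T , T ⟩ ≤ᶻ P * (w * s)
    lower = subst₂ _≤ᶻ_
      (cong (λ m → φ m * ⟨ T , T ⟩) length-generators)
      (cong₂ _*_ (cong (Q ^ᶻ_) length-generators)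
        (Φ-characteristic S independent φ (cubic-degree c)))
      (Φ-lowerBound generators φ (cubic-nonNeg c) f)

    cube : ∀ Q → Q * Q * Q ≡ Q * (Q * (Q * 1ℤ))
    cube = solve-∀

    swap : ∀ a b c → a * (b * c) ≡ b * (a * c)
    swap = solve-∀

    regroup : ∀ K N P w s → K * (N * (P * (w * s))) ≡ N * P * s * (K * w)
    regroup = solve-∀

    expandˡ : ∀ Q P s n c →
      + 6 * (1ℤ + n) * s * (P * P) * (s * (Q * Q * Q * (n - c) * (n + 1ℤ - c))) ≡
      + 6 * (Q * Q * Q) * ((1ℤ + n) * (1ℤ + n - c) * (1ℤ + n - c - 1ℤ) * (P * s * (P * s)))
    expandˡ = solve-∀

    expandʳ : ∀ N P s n num → N * P * s * (P * (+ 6 * (1ℤ + n) * num)) ≡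
                              + 6 * (1ℤ + n) * s * (P * P) * (N * num)
    expandʳ = solve-∀

-- Passage to the rationals, rounding and the conclusion.

toℚᵘ-fromℤ : ∀ i → ℚ.toℚᵘ (fromℤ i) ℚᵘ.≃ ℚᵘ.mkℚᵘ i 0
toℚᵘ-fromℤ i = ℚ.toℚᵘ-fromℚᵘ (ℚᵘ.mkℚᵘ i 0)

-- The comparison is made among unnormalised fractions, where a product over denominator 1 involves
-- no reduction to lowest terms.
fromℤ-homo-* : ∀ i j → fromℤ (i * j) ≡ fromℤ i ℚ.* fromℤ j
fromℤ-homo-* i j = ℚ.toℚᵘ-injective (begin
  ℚ.toℚᵘ (fromℤ (i * j))                          ≈⟨ toℚᵘ-fromℤ (i * j) ⟩
  ℚᵘ.mkℚᵘ i 0 ℚᵘ.* ℚᵘ.mkℚᵘ j 0                    ≈⟨ ℚᵘ.*-cong (toℚᵘ-fromℤ i) (toℚᵘ-fromℤ j) ⟨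
  ℚ.toℚᵘ (fromℤ i) ℚᵘ.* ℚ.toℚᵘ (fromℤ j)          ≈⟨ ℚ.toℚᵘ-homo-* (fromℤ i) (fromℤ j) ⟨
  ℚ.toℚᵘ (fromℤ i ℚ.* fromℤ j)                    ∎)
  where open ℚᵘ.≃-Reasoning

fromℤ-mono-≤ : ∀ {i j} → i ≤ᶻ j → fromℤ i ℚ.≤ fromℤ j
fromℤ-mono-≤ {i} {j} i≤j = ℚ.toℚᵘ-cancel-≤ (begin
  ℚ.toℚᵘ (fromℤ i)     ≃⟨ toℚᵘ-fromℤ i ⟩
  ℚᵘ.mkℚᵘ i 0          ≤⟨ ℚᵘ.*≤* (ℤ.*-monoʳ-≤-nonNeg 1ℤ i≤j) ⟩
  ℚᵘ.mkℚᵘ j 0          ≃⟨ toℚᵘ-fromℤ j ⟨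
  ℚ.toℚᵘ (fromℤ j)     ∎)
  where open ℚᵘ.≤-Reasoning

fromℤ≤÷ : ∀ i j k d .{{_ : ℚ.NonZero (fromℤ d)}} → 0ℤ < d →
          i * d ≤ᶻ j * k → fromℤ i ℚ.≤ fromℤ j ℚ.* (fromℤ k ℚ.÷ fromℤ d)
fromℤ≤÷ i j k d 0<d id≤jk = ℚ.*-cancelʳ-≤-pos (fromℤ d) {{fromℤ-pos (positive 0<d)}} (begin
  fromℤ i ℚ.* fromℤ d                       ≡⟨ fromℤ-homo-* i d ⟨
  fromℤ (i * d)                             ≤⟨ fromℤ-mono-≤ id≤jk ⟩
  fromℤ (j * k)                             ≡⟨ fromℤ-homo-* j k ⟩
  j′ ℚ.* k′                                 ≡⟨ cong (j′ ℚ.*_) (ℚ.*-identityʳ k′) ⟨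
  j′ ℚ.* (k′ ℚ.* ℚ.1ℚ)                      ≡⟨ cong (λ u → j′ ℚ.* (k′ ℚ.* u)) (ℚ.*-inverseˡ (fromℤ d)) ⟨
  j′ ℚ.* (k′ ℚ.* (ℚ.1/ fromℤ d ℚ.* fromℤ d)) ≡⟨ cong (j′ ℚ.*_) (ℚ.*-assoc k′ _ _) ⟨
  j′ ℚ.* (k′ ℚ.÷ fromℤ d ℚ.* fromℤ d)       ≡⟨ ℚ.*-assoc j′ _ _ ⟨
  j′ ℚ.* (k′ ℚ.÷ fromℤ d) ℚ.* fromℤ d       ∎)
  where
  open ℚ.≤-Reasoning
  j′ = fromℤ j
  k′ = fromℤ k

ceiling≡-floor- : ∀ p → ℚ.ceiling p ≡ - ℚ.floor (ℚ.- p)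
ceiling≡-floor- p@record{} = refl

-- A ceiling is by definition minus the floor of the negative. For `2 ≤ n` the integer 1 - n is a
-- negative constructor, so its fraction is definitionally the negative of that of n - 1.
⌊[1-n]/q⌋≡-⌈[n-1]/q⌉ : ∀ n q .{{_ : NonZero n}} .{{_ : NonZero q}} → 2 ≤ n →
                       ⌊[1-n]/q⌋ n q ≡ - ⌈[n-1]/q⌉ n q
⌊[1-n]/q⌋≡-⌈[n-1]/q⌉ (suc (suc n)) q (s≤s (s≤s _)) =
  sym (trans (cong -_ (ceiling≡-floor- (+ suc n ℚ./ q))) (ℤ.neg-involutive _))

-- A singleton is vacuously independent. Positivity is what permits cancelling the size of the set
-- in `ratioBound`.
1≤α : ∀ k G → FiniteGraph.Vertex G → 1 ≤ α k G
1≤α k G v = proj₂ (proj₂ (independenceNumber k))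
  (⁅ i ⁆ , ∣⁅x⁆∣≡1 i , λ x y x∈ y∈ x≢y → contradiction (index-injective (unique x∈ y∈)) x≢y)
  where
  open FiniteGraph G
  i = index v

  unique : ∀ {j k} → j ∈ ⁅ i ⁆ → k ∈ ⁅ i ⁆ → j ≡ k
  unique j∈ k∈ = trans (x∈⁅y⁆⇒x≡y i j∈) (sym (x∈⁅y⁆⇒x≡y i k∈))

  index-injective : ∀ {x y} → index x ≡ index y → x ≡ y
  index-injective {x} {y} eq =
    trans (sym (vertex-index x)) (trans (cong vertex eq) (vertex-index y))

-- Here `c` is chosen as the ceiling; since the floor is its negative, `n - c` and `n + 1 - c` turn
-- into the factors of `denominator`.
independent-bound : ∀ n q .{{_ : NonZero n}} .{{_ : NonZero q}} → 3 ≤ n → (F : FiniteField q) →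
  ∀ {a} → FiniteGraph.IndependentOfSize (G-pr F n) 3 a → 1 ≤ a →
  + a * denominator n q ≤ᶻ + (q ℕ.^ n) * numerator n q
independent-bound n q 3≤n F (S , refl , independent) 1≤∣S∣ = subst
  (λ f → + ∣ S ∣ * (+ (q ℕ.^ 3) * (+ n + f) * (+ n + 1ℤ + f)) ≤ᶻ + (q ℕ.^ n) * numerator n q)
  (sym (⌊[1-n]/q⌋≡-⌈[n-1]/q⌉ n q (ℕ.<⇒≤ 3≤n)))
  (Ratio.ratioBound F 3≤n S independent 1≤∣S∣ (⌈[n-1]/q⌉ n q))

theorem49 : (n q : ℕ) .{{_ : NonZero n}} .{{_ : NonZero q}} →
    3 ≤ n → 3 ≤ q → IsPrimePower q → (F : FiniteField q) →
    fromℤ (+ α 3 (G-pr F n)) ℚ.≤ bound n q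
theorem49 n q 3≤n _ _ F = fromℤ≤÷ (+ α 3 G) (+ (q ℕ.^ n)) (numerator n q) (denominator n q)
  {{denominator≢0 n q}} (0<denominator n q)
  -- The maximum is attained by an actual set, and the zero vector supplies the vertex that makes it
  -- nonempty.
  (independent-bound n q 3≤n F {α 3 G} (proj₁ (proj₂ (FiniteGraph.independenceNumber G 3)))
    (1≤α 3 G (PhaseRotation.0ᵛ F)))
  where
  G : FiniteGraph
  G = G-pr F n
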